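{- (1) (Type I) If $\ell$ is odd then $\varphi_\ell^{G_{\mathrm{I}}}\equiv0$; if $\ell$ is even then $\widetilde{\varphi_\ell^{G_{\mathrm{I}}}}(x,y)=x^\ell+y^\ell+\frac{2}{2+\sqrt2^{\,\ell}}\sum_{0<j<\ell,\ j\equiv0\ (\mathrm{mod}\ 2)}\binom{\ell}{j}x^{\ell-j}y^j.$ (2) (Type III) If $\ell\not\equiv0\pmod 4$ then $\varphi_\ell^{G_{\mathrm{III}}}\equiv0$; if $\ell\equiv0\pmod4$ then $\widetilde{\varphi_\ell^{G_{\mathrm{III}}}}(x,y)=x^\ell+\frac{3}{3+\sqrt3^{\,\ell}}\sum_{0<j\le\ell,\ j\equiv0\ (\mathrm{mod}\ 3)}2^j\binom{\ell}{j}x^{\ell-j}y^j.$ (3) (Type IV) If $\ell$ is odd then $\varphi_\ell^{G_{\mathrm{IV}}}\equiv0$; if $\ell$ is even then $\widetilde{\varphi_\ell^{G_{\mathrm{IV}}}}(x,y)=x^\ell+\frac{2}{2+2^{\ell}}\sum_{0<j\le\ell,\ j\equiv0\ (\mathrm{mod}\ 2)}3^j\binom{\ell}{j}x^{\ell-j}y^j.$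
   Context: $G_{\mathrm{I}}=\left\langle \frac{1}{\sqrt2}\begin{pmatrix}1&1\\1&-1\end{pmatrix},\begin{pmatrix}1&0\\0&-1\end{pmatrix}\right\rangle$, $G_{\mathrm{III}}=\left\langle \frac{1}{\sqrt3}\begin{pmatrix}1&2\\1&-1\end{pmatrix},\begin{pmatrix}1&0\\0&e^{2\pi\sqrt{ -1}/3}\end{pmatrix}\right\rangle$, $G_{\mathrm{IV}}=\left\langle \frac{1}{2}\begin{pmatrix}1&3\\1&-1\end{pmatrix},\begin{pmatrix}1&0\\0&-1\end{pmatrix}\right\rangle$ (finite matrix groups). For $\sigma=\begin{pmatrix}a&b\\c&d\end{pmatrix}$ put $\sigma x:=ax+by$, and for a nonnegative integer $\ell$ define $\varphi_\ell^{G_{\mathrm{X}}}(x,y)=\frac{1}{|G_{\mathrm{X}}|}\sum_{\sigma\in G_{\mathrm{X}}}(\sigma x)^\ell$. When $\varphi_\ell^{G_{\mathrm{X}}}\not\equiv0$, $\widetilde{\varphi_\ell^{G_{\mathrm{X}}}}$ is $\varphi_\ell^{G_{\mathrm{X}}}$ divided by its coefficient of $x^\ell$.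
   Formalization: In the even case of (1) the formal statement requires ℓ ≠ 0: at ℓ = 0 the normalised polynomial is 1, while the displayed formula gives x⁰ + y⁰ = 2, so the claim fails there. -}

module Defs where

open import Data.Nat as ℕ using (ℕ; zero; suc)
open import Data.Nat.Combinatorics using (_C_)
open import Data.Integer as ℤ using (ℤ; +_; -[1+_])
open import Data.Rational as ℚ using (ℚ; 0ℚ; 1ℚ)
open import Data.Vec using (Vec; []; _∷_; replicate; zipWith; map)
open import Data.List as List using (List; []; _∷_; length)
open import Data.List.Membership.Propositional using (_∈_)
open import Data.List.Relation.Unary.Unique.Propositional using (Unique)
open import Data.Product using (_×_)
open import Function.Bundles using (_⇔_)
open import Relation.Binary.PropositionalEquality using (_≡_; _≢_)

-- The number field K = ℚ(ζ₂₄) = ℚ[z]/(z⁸ - z⁴ + 1), with ζ₂₄ = e^{2πi/24}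
-- represented by z.  Elements are canonical coefficient vectors
-- (a₀,…,a₇) over (normalised) ℚ, so propositional equality is field equality.
-- All matrix entries of G_I, G_III, G_IV lie in K.

K : Set
K = Vec ℚ 8

0K : K
0K = replicate 8 0ℚ

infixl 6 _+K_
infixl 7 _*K_ _•_

_+K_ : K → K → K
_+K_ = zipWith ℚ._+_

_•_ : ℚ → K → K
q • v = map (q ℚ.*_) v

ιℚ : ℚ → K
ιℚ q = q ∷ 0ℚ ∷ 0ℚ ∷ 0ℚ ∷ 0ℚ ∷ 0ℚ ∷ 0ℚ ∷ 0ℚ ∷ []

ιℕ : ℕ → K
ιℕ n = ιℚ (ℤ.+ n ℚ./ 1)

1K : K
1K = ιℚ 1ℚ

-- multiplication by z, using z⁸ = z⁴ - 1
timesZ : K → K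
timesZ (a0 ∷ a1 ∷ a2 ∷ a3 ∷ a4 ∷ a5 ∷ a6 ∷ a7 ∷ []) =
  ℚ.- a7 ∷ a0 ∷ a1 ∷ a2 ∷ (a3 ℚ.+ a7) ∷ a4 ∷ a5 ∷ a6 ∷ []

mulAux : ∀ {n} → Vec ℚ n → K → K
mulAux []       q = 0K
mulAux (a ∷ as) q = a • q +K timesZ (mulAux as q)

_*K_ : K → K → K
p *K q = mulAux p q

infixr 8 _^K_
_^K_ : K → ℕ → K
x ^K zero  = 1K
x ^K suc n = x *K (x ^K n)

-- Distinguished elements (in the embedding z ↦ e^{2πi/24}):
-- √2 = z + z³ - z⁵,  √3 = 2z² - z⁶,  e^{2πi/3} = z⁸ = z⁴ - 1.
half third : ℚ
half  = ℤ.+ 1 ℚ./ 2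
third = ℤ.+ 1 ℚ./ 3

sqrt2 : K
sqrt2 = 0ℚ ∷ 1ℚ ∷ 0ℚ ∷ 1ℚ ∷ 0ℚ ∷ ℚ.- 1ℚ ∷ 0ℚ ∷ 0ℚ ∷ []

sqrt3 : K
sqrt3 = 0ℚ ∷ 0ℚ ∷ (ℤ.+ 2 ℚ./ 1) ∷ 0ℚ ∷ 0ℚ ∷ 0ℚ ∷ ℚ.- 1ℚ ∷ 0ℚ ∷ []

omega : K
omega = ℚ.- 1ℚ ∷ 0ℚ ∷ 0ℚ ∷ 0ℚ ∷ 1ℚ ∷ 0ℚ ∷ 0ℚ ∷ 0ℚ ∷ []

invSqrt2 : K
invSqrt2 = half • sqrt2

invSqrt3 : K
invSqrt3 = third • sqrt3

record Mat : Set where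
  constructor mat
  field
    a b c d : K

_*M_ : Mat → Mat → Mat
mat a b c d *M mat a' b' c' d' =
  mat (a *K a' +K b *K c') (a *K b' +K b *K d')
      (c *K a' +K d *K c') (c *K b' +K d *K d')

IdM : Mat
IdM = mat 1K 0K 0K 1K

data Gen (g h : Mat) : Mat → Set where
  gen₁ : Gen g h g
  gen₂ : Gen g h h
  one  : Gen g h IdM
  mul  : ∀ {σ τ} → Gen g h σ → Gen g h τ → Gen g h (σ *M τ)
  inv  : ∀ {σ τ} → Gen g h σ → σ *M τ ≡ IdM → Gen g h τ

HI SI : Mat
HI = mat invSqrt2 invSqrt2 invSqrt2 (ℚ.- 1ℚ • invSqrt2)
SI = mat 1K 0K 0K (ιℚ (ℚ.- 1ℚ))

HIII SIII : Mat
HIII = mat invSqrt3 ((ℤ.+ 2 ℚ./ 1) • invSqrt3) invSqrt3 (ℚ.- 1ℚ • invSqrt3)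
SIII = mat 1K 0K 0K omega

HIV SIV : Mat
HIV = mat (ιℚ half) (ιℚ (ℤ.+ 3 ℚ./ 2)) (ιℚ half) (ιℚ (ℚ.- half))
SIV = mat 1K 0K 0K (ιℚ (ℚ.- 1ℚ))

G-I G-III G-IV : Mat → Set
G-I   = Gen HI SI
G-III = Gen HIII SIII
G-IV  = Gen HIV SIV

Enumerates : List Mat → (Mat → Set) → Set
Enumerates L G = Unique L × (∀ σ → (σ ∈ L) ⇔ G σ)

-- φ_ℓ^G(x,y) = (1/|G|) Σ_{σ∈G} (a_σ x + b_σ y)^ℓ  is a homogeneous
-- polynomial of degree ℓ; we record it by its coefficients:
-- coeff L ℓ j = coefficient of x^{ℓ-j} y^j (0 ≤ j ≤ ℓ), where L enumerates G,
-- i.e.  (1/|G|) Σ_{σ∈G} C(ℓ,j) a_σ^{ℓ-j} b_σ^j.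

invLength : List Mat → ℚ
invLength []       = 0ℚ
invLength (_ ∷ xs) = ℤ.+ 1 ℚ./ suc (length xs)

sumK : List K → K
sumK = List.foldr _+K_ 0K

phiCoeff : List Mat → ℕ → ℕ → K
phiCoeff L ℓ j =
  invLength L • sumK (List.map (λ σ → ιℕ (ℓ C j) *K (Mat.a σ ^K (ℓ ℕ.∸ j)) *K (Mat.b σ ^K j)) L)

PhiZero : List Mat → ℕ → Set
PhiZero L ℓ = ∀ j → j ℕ.≤ ℓ → phiCoeff L ℓ j ≡ 0K

-- "φ̃_ℓ = Σ_j t_j x^{ℓ-j} y^j" where the target coefficient t_j = N_j / D is
-- given by a numerator N_j and a common (nonzero) denominator D:
-- φ_ℓ ≢ 0 via its x^ℓ-coefficient c₀ ≠ 0, and c_j / c₀ = N_j / D,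
-- written without division as  c_j · D = c₀ · N_j.
NormalisedIs : List Mat → ℕ → K → (ℕ → K) → Set
NormalisedIs L ℓ D N =
  (phiCoeff L ℓ 0 ≢ 0K) × (∀ j → j ℕ.≤ ℓ → phiCoeff L ℓ j *K D ≡ phiCoeff L ℓ 0 *K N j)

open import Relation.Nullary.Decidable using (⌊_⌋)
open import Data.Bool using (Bool; true; false; if_then_else_; _∧_; _∨_)
open import Data.Nat.Divisibility using (_∣?_)

DenI : ℕ → K
DenI ℓ = ιℕ 2 +K sqrt2 ^K ℓ

NumI : ℕ → ℕ → K
NumI ℓ j =
  (if ⌊ j ℕ.≟ 0 ⌋ then DenI ℓ else 0K) +K
  (if ⌊ j ℕ.≟ ℓ ⌋ then DenI ℓ else 0K) +K
  (if ⌊ 0 ℕ.<? j ⌋ ∧ ⌊ j ℕ.<? ℓ ⌋ ∧ ⌊ 2 ∣? j ⌋ then ιℕ 2 *K ιℕ (ℓ C j) else 0K)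

DenIII : ℕ → K
DenIII ℓ = ιℕ 3 +K sqrt3 ^K ℓ

NumIII : ℕ → ℕ → K
NumIII ℓ j =
  (if ⌊ j ℕ.≟ 0 ⌋ then DenIII ℓ else 0K) +K
  (if ⌊ 0 ℕ.<? j ⌋ ∧ ⌊ j ℕ.≤? ℓ ⌋ ∧ ⌊ 3 ∣? j ⌋ then ιℕ 3 *K ιℕ (2 ℕ.^ j) *K ιℕ (ℓ C j) else 0K)

DenIV : ℕ → K
DenIV ℓ = ιℕ 2 +K ιℕ 2 ^K ℓ

NumIV : ℕ → ℕ → K
NumIV ℓ j =
  (if ⌊ j ℕ.≟ 0 ⌋ then DenIV ℓ else 0K) +K
  (if ⌊ 0 ℕ.<? j ⌋ ∧ ⌊ j ℕ.≤? ℓ ⌋ ∧ ⌊ 2 ∣? j ⌋ then ιℕ 2 *K ιℕ (3 ℕ.^ j) *K ιℕ (ℓ C j) else 0K)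

{-# OPTIONS --safe #-}

-- A matrix of each group is u·diag(1,w)·M with u a scalar in the group, w in the group W of n-th roots
-- of unity (n = 2, 3, 2) and M either monomial with first row (1,0) (for type I also (0,1)) or with
-- first row s(1, t w′), w′ ∈ W.  That these lists are closed under the generators is a finite
-- computation.  As (u a)^(ℓ-j) (u b)^j = u^ℓ a^(ℓ-j) b^j, the coefficient of x^(ℓ-j) y^j factors as
-- a constant times (Σ u^ℓ)·C(ℓ,j)·(monomial part + s^ℓ t^j Σ w′^j).  The sums over roots of unity
-- vanish off the multiples of the order, and with r = 1/s the bracket at j = 0 is s^ℓ(n + r^ℓ).
module Submission where

open import Defs
open import Algebra.Bundles using (CommutativeMonoid; CommutativeSemiring)
import Algebra.Properties.CommutativeSemigroup as CommutativeSemigroupProperties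
open import Data.Bool using (if_then_else_; _∧_)
open import Data.Empty using (⊥-elim)
open import Data.Integer as ℤ using (+_)
import Data.Integer.Properties as ℤ
open import Data.List as List using (List; []; _∷_; length; _++_; cartesianProductWith)
open import Data.List.Membership.Propositional using (_∈_)
open import Data.List.Membership.Propositional.Properties using (∈-cartesianProductWith⁻)
open import Data.List.Membership.Propositional.Properties.WithK using (unique∧set⇒bag)
import Data.List.Properties as List
open import Data.List.Relation.Binary.BagAndSetEquality using (∼bag⇒↭)
open import Data.List.Relation.Binary.Permutation.Propositional as Perm using (_↭_)
open import Data.List.Relation.Binary.Permutation.Propositional.Properties using (↭-length; map⁺)
open import Data.List.Relation.Unary.All as All using (All; []; _∷_; all?)
open import Data.List.Relation.Unary.Unique.Propositional using (Unique)
open import Data.Nat as ℕ using (ℕ; zero; suc; s≤s; z≤n)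
open import Data.Nat.Combinatorics using (_C_; nCn≡1; nCk≡nC[n∸k])
open import Data.Nat.Divisibility using (_∣_; divides; _∣?_; _∣0; m%n≡0⇒n∣m; n∣m⇒m%n≡0)
open import Data.Nat.DivMod using (_%_; _/_; m≡m%n+[m/n]*n; m%n<n)
import Data.Nat.Properties as ℕ
open import Data.Product using (_×_; _,_; ∃; proj₁)
open import Data.Rational as ℚ using (ℚ; 0ℚ; 1ℚ)
import Data.Rational.Properties as ℚ
open import Data.Rational.Unnormalised as ℚᵘ using (mkℚᵘ; *≡*)
import Data.Rational.Unnormalised.Properties as ℚᵘ
open import Data.Vec as Vec using (Vec; []; _∷_; zipWith; replicate)
import Data.Vec.Properties as Vec
open import Function.Bundles using (mk⇔)
open import Function.Properties.Equivalence using () renaming (trans to ⇔-trans; sym to ⇔-sym)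
open import Level using (0ℓ)
open import Relation.Binary using (DecidableEquality)
open import Relation.Binary.PropositionalEquality
open import Relation.Nullary using (¬_; Dec; yes; no)
open import Relation.Nullary.Decidable using (map′; _×-dec_; from-yes; ⌊_⌋; True; toWitness)

-- The ring K

-- The three non-diagonal generators are s times the matrix with rows (1, t) and (1, -1), where t =
-- q - 1 and s = 1/√q for q = 2, 3, 4, the matrices of the MacWilliams identity. Hence one argument
-- in the parameters n, t, s, r covers all types, and only the swap of the two variables sets type I
-- apart. `K` comes as bare coefficient vectors, so its ring laws have to be proved. They rest on
-- reading `mulAux as q` as Horner's scheme: the polynomial with coefficients `as`, evaluated at the
-- operator `timesZ` and applied to `q`. No order and no general inverses are constructed on `K`.
-- Common factors of the coefficients are cancelled by explicit inverses, and the denominator is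
-- nonzero since divisibility of ℓ turns r^ℓ into a natural number, which makes n + r^ℓ a positive
-- integer. The statement concerns any list that enumerates the group, so it must also be shown that
-- the coefficients depend neither on the order of the list nor on its choice.

/1-homo-+ : ∀ m n → + (m ℕ.+ n) ℚ./ 1 ≡ (+ m ℚ./ 1) ℚ.+ (+ n ℚ./ 1)
-- The fraction `+ m ℚ./ 1` is normalised through a gcd, which does not reduce for a variable `m`.
-- Among unnormalised rationals only an identity of integers remains.
/1-homo-+ m n = ℚ.toℚᵘ-injective (begin-equality
  ℚ.toℚᵘ (ℚ.fromℚᵘ (mkℚᵘ (+ (m ℕ.+ n)) 0))
    ≃⟨ ℚ.toℚᵘ-fromℚᵘ (mkℚᵘ (+ (m ℕ.+ n)) 0) ⟩
  mkℚᵘ (+ (m ℕ.+ n)) 0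
    ≃⟨ *≡* (cong (ℤ._* + 1) (cong₂ ℤ._+_ (sym (ℤ.*-identityʳ (+ m))) (sym (ℤ.*-identityʳ (+ n))))) ⟩
  mkℚᵘ (+ m) 0 ℚᵘ.+ mkℚᵘ (+ n) 0
    ≃⟨ ℚᵘ.+-cong (ℚ.toℚᵘ-fromℚᵘ (mkℚᵘ (+ m) 0)) (ℚ.toℚᵘ-fromℚᵘ (mkℚᵘ (+ n) 0)) ⟨
  ℚ.toℚᵘ (+ m ℚ./ 1) ℚᵘ.+ ℚ.toℚᵘ (+ n ℚ./ 1)
    ≃⟨ ℚ.toℚᵘ-homo-+ (+ m ℚ./ 1) (+ n ℚ./ 1) ⟨
  ℚ.toℚᵘ ((+ m ℚ./ 1) ℚ.+ (+ n ℚ./ 1)) ∎)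
  where open ℚᵘ.≤-Reasoning

/1-homo-* : ∀ m n → + (m ℕ.* n) ℚ./ 1 ≡ (+ m ℚ./ 1) ℚ.* (+ n ℚ./ 1)
/1-homo-* m n = ℚ.toℚᵘ-injective (begin-equality
  ℚ.toℚᵘ (ℚ.fromℚᵘ (mkℚᵘ (+ (m ℕ.* n)) 0))
    ≃⟨ ℚ.toℚᵘ-fromℚᵘ (mkℚᵘ (+ (m ℕ.* n)) 0) ⟩
  mkℚᵘ (+ (m ℕ.* n)) 0
    ≃⟨ *≡* (cong (ℤ._* + 1) (ℤ.pos-* m n)) ⟩
  mkℚᵘ (+ m) 0 ℚᵘ.* mkℚᵘ (+ n) 0
    ≃⟨ ℚᵘ.*-cong (ℚ.toℚᵘ-fromℚᵘ (mkℚᵘ (+ m) 0)) (ℚ.toℚᵘ-fromℚᵘ (mkℚᵘ (+ n) 0)) ⟨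
  ℚ.toℚᵘ (+ m ℚ./ 1) ℚᵘ.* ℚ.toℚᵘ (+ n ℚ./ 1)
    ≃⟨ ℚ.toℚᵘ-homo-* (+ m ℚ./ 1) (+ n ℚ./ 1) ⟨
  ℚ.toℚᵘ ((+ m ℚ./ 1) ℚ.* (+ n ℚ./ 1)) ∎)
  where open ℚᵘ.≤-Reasoning

open ≡-Reasoning

+K-assoc : ∀ x y z → (x +K y) +K z ≡ x +K (y +K z)
+K-assoc = Vec.zipWith-assoc ℚ.+-assoc

+K-comm : ∀ x y → x +K y ≡ y +K x
+K-comm = Vec.zipWith-comm ℚ.+-comm

+K-identityˡ : ∀ x → 0K +K x ≡ x
+K-identityˡ = Vec.zipWith-identityˡ ℚ.+-identityˡ

+K-identityʳ : ∀ x → x +K 0K ≡ x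
+K-identityʳ = Vec.zipWith-identityʳ ℚ.+-identityʳ

+K-commutativeMonoid : CommutativeMonoid 0ℓ 0ℓ
+K-commutativeMonoid = record
  { isCommutativeMonoid = record
    { isMonoid = record
      { isSemigroup = record
        { isMagma = record { isEquivalence = isEquivalence ; ∙-cong = cong₂ _+K_ }
        ; assoc = +K-assoc }
      ; identity = +K-identityˡ , +K-identityʳ }
    ; comm = +K-comm } }

open CommutativeSemigroupProperties (CommutativeMonoid.commutativeSemigroup +K-commutativeMonoid)
  using () renaming (interchange to +K-interchange)
open CommutativeSemigroupProperties (CommutativeMonoid.commutativeSemigroup ℚ.+-0-commutativeMonoid)
  using () renaming (interchange to +-interchange)

•-distribˡ : ∀ {n} c (x y : Vec ℚ n) →
  Vec.map (c ℚ.*_) (zipWith ℚ._+_ x y) ≡ zipWith ℚ._+_ (Vec.map (c ℚ.*_) x) (Vec.map (c ℚ.*_) y)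
•-distribˡ c [] [] = refl
•-distribˡ c (x ∷ xs) (y ∷ ys) = cong₂ _∷_ (ℚ.*-distribˡ-+ c x y) (•-distribˡ c xs ys)

•-distribʳ : ∀ {n} c d (x : Vec ℚ n) →
  Vec.map ((c ℚ.+ d) ℚ.*_) x ≡ zipWith ℚ._+_ (Vec.map (c ℚ.*_) x) (Vec.map (d ℚ.*_) x)
•-distribʳ c d [] = refl
•-distribʳ c d (x ∷ xs) = cong₂ _∷_ (ℚ.*-distribʳ-+ x c d) (•-distribʳ c d xs)

•-assoc : ∀ {n} c d (x : Vec ℚ n) →
  Vec.map ((c ℚ.* d) ℚ.*_) x ≡ Vec.map (c ℚ.*_) (Vec.map (d ℚ.*_) x)
•-assoc c d [] = refl
•-assoc c d (x ∷ xs) = cong₂ _∷_ (ℚ.*-assoc c d x) (•-assoc c d xs)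

•-zeroˡ : ∀ {n} (x : Vec ℚ n) → Vec.map (0ℚ ℚ.*_) x ≡ replicate n 0ℚ
•-zeroˡ [] = refl
•-zeroˡ (x ∷ xs) = cong₂ _∷_ (ℚ.*-zeroˡ x) (•-zeroˡ xs)

•-zeroʳ : ∀ {n} c → Vec.map (c ℚ.*_) (replicate n 0ℚ) ≡ replicate n 0ℚ
•-zeroʳ {zero} c = refl
•-zeroʳ {suc n} c = cong₂ _∷_ (ℚ.*-zeroʳ c) (•-zeroʳ {n} c)

•-comm : ∀ c d (x : K) → c • (d • x) ≡ d • (c • x)
•-comm c d x = begin
  c • (d • x)    ≡⟨ •-assoc c d x ⟨
  (c ℚ.* d) • x  ≡⟨ cong (_• x) (ℚ.*-comm c d) ⟩
  (d ℚ.* c) • x  ≡⟨ •-assoc d c x ⟩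
  d • (c • x)    ∎

cong₈ : ∀ {a0 a1 a2 a3 a4 a5 a6 a7 b0 b1 b2 b3 b4 b5 b6 b7 : ℚ} →
  a0 ≡ b0 → a1 ≡ b1 → a2 ≡ b2 → a3 ≡ b3 → a4 ≡ b4 → a5 ≡ b5 → a6 ≡ b6 → a7 ≡ b7 →
  _≡_ {A = K} (a0 ∷ a1 ∷ a2 ∷ a3 ∷ a4 ∷ a5 ∷ a6 ∷ a7 ∷ []) (b0 ∷ b1 ∷ b2 ∷ b3 ∷ b4 ∷ b5 ∷ b6 ∷ b7 ∷ [])
cong₈ refl refl refl refl refl refl refl refl = refl

timesZ-+ : ∀ x y → timesZ (x +K y) ≡ timesZ x +K timesZ y
timesZ-+ (a0 ∷ a1 ∷ a2 ∷ a3 ∷ a4 ∷ a5 ∷ a6 ∷ a7 ∷ []) (b0 ∷ b1 ∷ b2 ∷ b3 ∷ b4 ∷ b5 ∷ b6 ∷ b7 ∷ []) =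
  cong₈ (ℚ.neg-distrib-+ a7 b7) refl refl refl (+-interchange a3 b3 a7 b7) refl refl refl

timesZ-• : ∀ c x → timesZ (c • x) ≡ c • timesZ x
timesZ-• c (a0 ∷ a1 ∷ a2 ∷ a3 ∷ a4 ∷ a5 ∷ a6 ∷ a7 ∷ []) =
  cong₈ (ℚ.neg-distribʳ-* c a7) refl refl refl (sym (ℚ.*-distribˡ-+ c a3 a7)) refl refl refl

timesZ^ : ℕ → K → K
timesZ^ zero    x = x
timesZ^ (suc n) x = timesZ (timesZ^ n x)

-- The relation z⁸ = z⁴ - 1, read as an identity between operators.
timesZ^8 : ∀ x → timesZ^ 8 x ≡ timesZ^ 4 x +K ((ℚ.- 1ℚ) • x)
timesZ^8 (a0 ∷ a1 ∷ a2 ∷ a3 ∷ a4 ∷ a5 ∷ a6 ∷ a7 ∷ []) =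
  cong₈ (low a0 a4) (low a1 a5) (low a2 a6) (low a3 a7) (high a0 a4) (high a1 a5) (high a2 a6) (high a3 a7)
  where
  neg : ∀ a → ℚ.- a ≡ (ℚ.- 1ℚ) ℚ.* a
  neg a = trans (cong ℚ.-_ (sym (ℚ.*-identityˡ a))) (ℚ.neg-distribˡ-* 1ℚ a)
  low : ∀ a b → ℚ.- (a ℚ.+ b) ≡ ℚ.- b ℚ.+ (ℚ.- 1ℚ) ℚ.* a
  low a b = trans (ℚ.neg-distrib-+ a b) (trans (ℚ.+-comm (ℚ.- a) (ℚ.- b)) (cong (ℚ.- b ℚ.+_) (neg a)))
  high : ∀ a b → ℚ.- b ℚ.+ (a ℚ.+ b) ≡ (a ℚ.+ b) ℚ.+ (ℚ.- 1ℚ) ℚ.* b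
  high a b = trans (ℚ.+-comm (ℚ.- b) (a ℚ.+ b)) (cong ((a ℚ.+ b) ℚ.+_) (neg b))

-- Horner's recursion shortens the coefficient vector, so the laws are proved for every length; the
-- product of `K` is the case of length 8.
mulAux-+ˡ : ∀ {n} (as bs : Vec ℚ n) q → mulAux (zipWith ℚ._+_ as bs) q ≡ mulAux as q +K mulAux bs q
mulAux-+ˡ [] [] q = refl
mulAux-+ˡ (a ∷ as) (b ∷ bs) q = begin
  (a ℚ.+ b) • q +K timesZ (mulAux (zipWith ℚ._+_ as bs) q)
    ≡⟨ cong₂ _+K_ (•-distribʳ a b q) (trans (cong timesZ (mulAux-+ˡ as bs q)) (timesZ-+ _ _)) ⟩
  (a • q +K b • q) +K (timesZ (mulAux as q) +K timesZ (mulAux bs q))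
    ≡⟨ +K-interchange _ _ _ _ ⟩
  (a • q +K timesZ (mulAux as q)) +K (b • q +K timesZ (mulAux bs q)) ∎

mulAux-•ˡ : ∀ {n} c (as : Vec ℚ n) q → mulAux (Vec.map (c ℚ.*_) as) q ≡ c • mulAux as q
mulAux-•ˡ c [] q = sym (•-zeroʳ {8} c)
mulAux-•ˡ c (a ∷ as) q = begin
  (c ℚ.* a) • q +K timesZ (mulAux (Vec.map (c ℚ.*_) as) q)
    ≡⟨ cong₂ _+K_ (•-assoc c a q) (trans (cong timesZ (mulAux-•ˡ c as q)) (timesZ-• c _)) ⟩
  c • (a • q) +K c • timesZ (mulAux as q)
    ≡⟨ •-distribˡ c _ _ ⟨
  c • (a • q +K timesZ (mulAux as q)) ∎

mulAux-zeroˡ : ∀ n q → mulAux (replicate n 0ℚ) q ≡ 0K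
mulAux-zeroˡ zero q = refl
mulAux-zeroˡ (suc n) q = cong₂ _+K_ (•-zeroˡ q) (cong timesZ (mulAux-zeroˡ n q))

mulAux-∷-zeros : ∀ n c q → mulAux (c ∷ replicate n 0ℚ) q ≡ c • q
mulAux-∷-zeros n c q = trans (cong (λ x → c • q +K timesZ x) (mulAux-zeroˡ n q)) (+K-identityʳ (c • q))

mulAux-+ʳ : ∀ {n} (as : Vec ℚ n) q r → mulAux as (q +K r) ≡ mulAux as q +K mulAux as r
mulAux-+ʳ [] q r = refl
mulAux-+ʳ (a ∷ as) q r = begin
  a • (q +K r) +K timesZ (mulAux as (q +K r))
    ≡⟨ cong₂ _+K_ (•-distribˡ a q r) (trans (cong timesZ (mulAux-+ʳ as q r)) (timesZ-+ _ _)) ⟩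
  (a • q +K a • r) +K (timesZ (mulAux as q) +K timesZ (mulAux as r))
    ≡⟨ +K-interchange _ _ _ _ ⟩
  (a • q +K timesZ (mulAux as q)) +K (a • r +K timesZ (mulAux as r)) ∎

mulAux-•ʳ : ∀ {n} c (as : Vec ℚ n) q → mulAux as (c • q) ≡ c • mulAux as q
mulAux-•ʳ c [] q = sym (•-zeroʳ {8} c)
mulAux-•ʳ c (a ∷ as) q = begin
  a • (c • q) +K timesZ (mulAux as (c • q))
    ≡⟨ cong₂ _+K_ (•-comm a c q) (trans (cong timesZ (mulAux-•ʳ c as q)) (timesZ-• c _)) ⟩
  c • (a • q) +K c • timesZ (mulAux as q)
    ≡⟨ •-distribˡ c _ _ ⟨
  c • (a • q +K timesZ (mulAux as q)) ∎

mulAux-timesZʳ : ∀ {n} (as : Vec ℚ n) q → mulAux as (timesZ q) ≡ timesZ (mulAux as q)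
mulAux-timesZʳ [] q = refl
mulAux-timesZʳ (a ∷ as) q = begin
  a • timesZ q +K timesZ (mulAux as (timesZ q))
    ≡⟨ cong₂ _+K_ (sym (timesZ-• a q)) (cong timesZ (mulAux-timesZʳ as q)) ⟩
  timesZ (a • q) +K timesZ (timesZ (mulAux as q))
    ≡⟨ timesZ-+ _ _ ⟨
  timesZ (a • q +K timesZ (mulAux as q)) ∎

-- Horner's scheme opens a polynomial at its constant term. Opening it at the leading term instead
-- exposes the coefficient of z⁸ that has to be reduced.
mulAux-∷ʳ : ∀ {n} (as : Vec ℚ n) a q → mulAux (as Vec.∷ʳ a) q ≡ mulAux as q +K timesZ^ n (a • q)
mulAux-∷ʳ [] a q = trans (mulAux-∷-zeros 0 a q) (sym (+K-identityˡ _))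
mulAux-∷ʳ (b ∷ as) a q =
  trans (cong (λ x → b • q +K x) (trans (cong timesZ (mulAux-∷ʳ as a q)) (timesZ-+ _ _))) (sym (+K-assoc (b • q) _ _))

-- Multiply by z without reducing, as a vector of length 9: its last entry a₇ sits at z⁸ = z⁴ - 1,
-- which is where timesZ puts it.
timesZ-*ˡ : ∀ p q → timesZ p *K q ≡ timesZ (p *K q)
timesZ-*ˡ p@(a0 ∷ a1 ∷ a2 ∷ a3 ∷ a4 ∷ a5 ∷ a6 ∷ a7 ∷ []) q = begin
  timesZ p *K q
    ≡⟨ cong (_*K q) split ⟩
  (shifted +K corner) *K q
    ≡⟨ mulAux-+ˡ shifted corner q ⟩
  (shifted *K q) +K (corner *K q)
    ≡⟨ cong ((shifted *K q) +K_) corner-* ⟩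
  (shifted *K q) +K timesZ^ 8 (a7 • q)
    ≡⟨ mulAux-∷ʳ shifted a7 q ⟨
  mulAux (0ℚ ∷ p) q
    ≡⟨ cong (_+K timesZ (p *K q)) (•-zeroˡ q) ⟩
  0K +K timesZ (p *K q)
    ≡⟨ +K-identityˡ _ ⟩
  timesZ (p *K q) ∎
  where
  shifted corner : K
  shifted = 0ℚ ∷ a0 ∷ a1 ∷ a2 ∷ a3 ∷ a4 ∷ a5 ∷ a6 ∷ []
  corner = ℚ.- a7 ∷ 0ℚ ∷ 0ℚ ∷ 0ℚ ∷ a7 ∷ 0ℚ ∷ 0ℚ ∷ 0ℚ ∷ []
  +0 : ∀ a → a ≡ a ℚ.+ 0ℚ
  +0 a = sym (ℚ.+-identityʳ a)
  split : timesZ p ≡ shifted +K corner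
  split = cong₈ (sym (ℚ.+-identityˡ (ℚ.- a7))) (+0 a0) (+0 a1) (+0 a2) refl (+0 a4) (+0 a5) (+0 a6)
  corner₃ : mulAux (0ℚ ∷ 0ℚ ∷ 0ℚ ∷ a7 ∷ 0ℚ ∷ 0ℚ ∷ 0ℚ ∷ []) q ≡ timesZ^ 3 (a7 • q)
  corner₃ = trans (step _) (cong timesZ (trans (step _) (cong timesZ (trans (step _) (cong timesZ (mulAux-∷-zeros 3 a7 q))))))
    where
    step : ∀ x → 0ℚ • q +K timesZ x ≡ timesZ x
    step x = trans (cong (_+K timesZ x) (•-zeroˡ q)) (+K-identityˡ _)
  corner-* : corner *K q ≡ timesZ^ 8 (a7 • q)
  corner-* = begin
    (ℚ.- a7) • q +K timesZ (mulAux (0ℚ ∷ 0ℚ ∷ 0ℚ ∷ a7 ∷ 0ℚ ∷ 0ℚ ∷ 0ℚ ∷ []) q)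
      ≡⟨ cong₂ _+K_ (trans (cong (_• q) (trans (cong ℚ.-_ (sym (ℚ.*-identityˡ a7))) (ℚ.neg-distribˡ-* 1ℚ a7)))
                           (•-assoc (ℚ.- 1ℚ) a7 q))
                    (cong timesZ corner₃) ⟩
    (ℚ.- 1ℚ) • (a7 • q) +K timesZ^ 4 (a7 • q)
      ≡⟨ +K-comm ((ℚ.- 1ℚ) • (a7 • q)) _ ⟩
    timesZ^ 4 (a7 • q) +K (ℚ.- 1ℚ) • (a7 • q)
      ≡⟨ timesZ^8 (a7 • q) ⟨
    timesZ^ 8 (a7 • q) ∎

-- Multiplication by `r` on the right commutes with scalars and with `timesZ`, hence with every
-- polynomial in `timesZ`. At length 8 this is associativity.
mulAux-*ˡ : ∀ {n} (as : Vec ℚ n) q r → mulAux as q *K r ≡ mulAux as (q *K r)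
mulAux-*ˡ [] q r = mulAux-zeroˡ 8 r
mulAux-*ˡ (a ∷ as) q r = begin
  (a • q +K timesZ (mulAux as q)) *K r
    ≡⟨ mulAux-+ˡ (a • q) _ r ⟩
  (a • q) *K r +K timesZ (mulAux as q) *K r
    ≡⟨ cong₂ _+K_ (mulAux-•ˡ a q r) (trans (timesZ-*ˡ (mulAux as q) r) (cong timesZ (mulAux-*ˡ as q r))) ⟩
  a • (q *K r) +K timesZ (mulAux as (q *K r)) ∎

-- The mirror image, for multiplication by `p` on the left. Applied to the unit it gives
-- commutativity.
mulAux-*ʳ : ∀ {n} p (as : Vec ℚ n) q → p *K mulAux as q ≡ mulAux as (p *K q)
-- Commutativity is not yet available to move the zero to the left, so 0 is written as the scalar
-- multiple 0 • 0 and the scalar is pulled out.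
mulAux-*ʳ p [] q = trans (cong (p *K_) (sym (•-zeroˡ 0K))) (trans (mulAux-•ʳ 0ℚ p 0K) (•-zeroˡ (p *K 0K)))
mulAux-*ʳ p (a ∷ as) q = begin
  p *K (a • q +K timesZ (mulAux as q))
    ≡⟨ mulAux-+ʳ p (a • q) _ ⟩
  p *K (a • q) +K p *K timesZ (mulAux as q)
    ≡⟨ cong₂ _+K_ (mulAux-•ʳ a p q) (trans (mulAux-timesZʳ p (mulAux as q)) (cong timesZ (mulAux-*ʳ p as q))) ⟩
  a • (p *K q) +K timesZ (mulAux as (p *K q)) ∎

-- Horner's scheme started at 1 rebuilds the vector entry by entry. Each vector that `timesZ` meets
-- on the way still has last entry 0, so it is merely shifted and no reduction takes place.
*K-identityʳ : ∀ p → p *K 1K ≡ p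
*K-identityʳ (a0 ∷ a1 ∷ a2 ∷ a3 ∷ a4 ∷ a5 ∷ a6 ∷ a7 ∷ []) =
  horner a0 (horner a1 (horner a2 (horner a3 (horner a4 (horner a5 (horner a6 (horner a7 refl)))))))
  where
  horner : ∀ a {b0 b1 b2 b3 b4 b5 b6 x} → x ≡ b0 ∷ b1 ∷ b2 ∷ b3 ∷ b4 ∷ b5 ∷ b6 ∷ 0ℚ ∷ [] →
    a • 1K +K timesZ x ≡ a ∷ b0 ∷ b1 ∷ b2 ∷ b3 ∷ b4 ∷ b5 ∷ b6 ∷ []
  horner a {b0} {b1} {b2} {b3} {b4} {b5} {b6} refl =
    cong₈ (trans (ℚ.+-identityʳ _) (ℚ.*-identityʳ a)) (drop b0) (drop b1) (drop b2)
          (trans (drop (b3 ℚ.+ 0ℚ)) (ℚ.+-identityʳ b3)) (drop b4) (drop b5) (drop b6)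
    where
    drop : ∀ b → a ℚ.* 0ℚ ℚ.+ b ≡ b
    drop b = trans (cong (ℚ._+ b) (ℚ.*-zeroʳ a)) (ℚ.+-identityˡ b)

*K-comm : ∀ p q → p *K q ≡ q *K p
*K-comm p q = begin
  p *K q          ≡⟨ cong (p *K_) (*K-identityʳ q) ⟨
  p *K (q *K 1K)  ≡⟨ mulAux-*ʳ p q 1K ⟩
  q *K (p *K 1K)  ≡⟨ cong (q *K_) (*K-identityʳ p) ⟩
  q *K p          ∎

K-commutativeSemiring : CommutativeSemiring 0ℓ 0ℓ
K-commutativeSemiring = record
  { Carrier = K
  ; _≈_ = _≡_
  ; _+_ = _+K_
  ; _*_ = _*K_
  ; 0# = 0K
  ; 1# = 1K
  ; isCommutativeSemiring = record
    { isSemiring = record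
      { isSemiringWithoutAnnihilatingZero = record
        { +-isCommutativeMonoid = CommutativeMonoid.isCommutativeMonoid +K-commutativeMonoid
        ; *-cong = cong₂ _*K_
        ; *-assoc = mulAux-*ˡ
        ; *-identity = (λ p → trans (*K-comm 1K p) (*K-identityʳ p)) , *K-identityʳ
        ; distrib = mulAux-+ʳ , (λ r p q → mulAux-+ˡ p q r) }
      ; zero = mulAux-zeroˡ 8 , (λ p → trans (*K-comm p 0K) (mulAux-zeroˡ 8 p)) }
    ; *-comm = *K-comm } }

-- Over an abstract semiring: over K itself the solver's normal forms would unfold into coordinates.
module Identities (R : CommutativeSemiring 0ℓ 0ℓ) where
  open CommutativeSemiring R using (_≈_; _+_; _*_; 0#; 1#) renaming (refl to ≈-refl)
  open import Algebra.Solver.Ring.NaturalCoefficients.Default R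

  private
    :0 :1 : ∀ {n} → Polynomial n
    :0 = con 0
    :1 = con 1

  matrix-assoc : ∀ a b a′ b′ c′ d′ a″ c″ →
    (a * a′ + b * c′) * a″ + (a * b′ + b * d′) * c″ ≈ a * (a′ * a″ + b′ * c″) + b * (c′ * a″ + d′ * c″)
  matrix-assoc = solve 8 (λ a b a′ b′ c′ d′ a″ c″ →
    (a :* a′ :+ b :* c′) :* a″ :+ (a :* b′ :+ b :* d′) :* c″ :=
    a :* (a′ :* a″ :+ b′ :* c″) :+ b :* (c′ :* a″ :+ d′ :* c″)) ≈-refl

  x+0y : ∀ x y → x + 0# * y ≈ x
  x+0y = solve 2 (λ x y → x :+ :0 :* y := x) ≈-refl

  0x+y : ∀ x y → 0# * x + y ≈ y
  0x+y = solve 2 (λ x y → :0 :* x :+ y := y) ≈-refl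

  1x+0y : ∀ x y → 1# * x + 0# * y ≈ x
  1x+0y = solve 2 (λ x y → :1 :* x :+ :0 :* y := x) ≈-refl

  0x+1y : ∀ x y → 0# * x + 1# * y ≈ y
  0x+1y = solve 2 (λ x y → :0 :* x :+ :1 :* y := y) ≈-refl

  x1+y0 : ∀ x y → x * 1# + y * 0# ≈ x
  x1+y0 = solve 2 (λ x y → x :* :1 :+ y :* :0 := x) ≈-refl

  x0+y1 : ∀ x y → x * 0# + y * 1# ≈ y
  x0+y1 = solve 2 (λ x y → x :* :0 :+ y :* :1 := y) ≈-refl

  pull-factors : ∀ c p x q y → c * (p * x) * (q * y) ≈ (p * q) * (c * x * y)
  pull-factors = solve 5 (λ c p x q y → c :* (p :* x) :* (q :* y) := (p :* q) :* (c :* x :* y)) ≈-refl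

  pull-line : ∀ c x y t w → c * x * (y * (t * w)) ≈ c * ((x * y) * t) * w
  pull-line = solve 5 (λ c x y t w → c :* x :* (y :* (t :* w)) := c :* ((x :* y) :* t) :* w) ≈-refl

  *-interchange : ∀ x y x′ y′ → (x * y) * (x′ * y′) ≈ (x * x′) * (y * y′)
  *-interchange = solve 4 (λ x y x′ y′ → (x :* y) :* (x′ :* y′) := (x :* x′) :* (y :* y′)) ≈-refl

  ratio : ∀ γ σ n d → (γ * (σ * n)) * d ≈ (γ * (σ * d)) * n
  ratio = solve 4 (λ γ σ n d → (γ :* (σ :* n)) :* d := (γ :* (σ :* d)) :* n) ≈-refl

  cancel-units : ∀ γ γ′ σ ρ d → (γ * (σ * d)) * (γ′ * ρ) ≈ (γ * γ′) * ((σ * ρ) * d)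
  cancel-units = solve 5 (λ γ γ′ σ ρ d → (γ :* (σ :* d)) :* (γ′ :* ρ) := (γ :* γ′) :* ((σ :* ρ) :* d)) ≈-refl

  leading : ∀ σ ρ n → σ * ρ + 1# * (σ * 1#) * n ≈ σ * (n + ρ)
  leading = solve 3 (λ σ ρ n → σ :* ρ :+ :1 :* (σ :* :1) :* n := σ :* (n :+ ρ)) ≈-refl

  middle : ∀ c σ τ n → c * (σ * τ) * n ≈ σ * (n * τ * c)
  middle = solve 4 (λ c σ τ n → c :* (σ :* τ) :* n := σ :* (n :* τ :* c)) ≈-refl

module KS = CommutativeSemiring K-commutativeSemiring
open Identities K-commutativeSemiring

-- Powers and natural numbers in `K`

^K-+ : ∀ x m n → x ^K (m ℕ.+ n) ≡ x ^K m *K x ^K n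
^K-+ x zero    n = sym (KS.*-identityˡ _)
^K-+ x (suc m) n = trans (cong (x *K_) (^K-+ x m n)) (sym (KS.*-assoc x _ _))

^K-* : ∀ x m n → x ^K (m ℕ.* n) ≡ (x ^K n) ^K m
^K-* x zero    n = refl
^K-* x (suc m) n = trans (^K-+ x n (m ℕ.* n)) (cong (x ^K n *K_) (^K-* x m n))

*K-^K : ∀ x y n → (x *K y) ^K n ≡ x ^K n *K y ^K n
*K-^K x y zero    = sym (KS.*-identityˡ 1K)
*K-^K x y (suc n) = trans (cong (x *K y *K_) (*K-^K x y n)) (*-interchange x y _ _)

1K-^K : ∀ n → 1K ^K n ≡ 1K
1K-^K zero    = refl
1K-^K (suc n) = trans (KS.*-identityˡ _) (1K-^K n)

ιℕ-homo-+ : ∀ m n → ιℕ (m ℕ.+ n) ≡ ιℕ m +K ιℕ n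
ιℕ-homo-+ m n = cong ιℚ (/1-homo-+ m n)

ιℕ-homo-* : ∀ m n → ιℕ (m ℕ.* n) ≡ ιℕ m *K ιℕ n
ιℕ-homo-* m n = begin
  ιℚ (+ (m ℕ.* n) ℚ./ 1)          ≡⟨ cong ιℚ (/1-homo-* m n) ⟩
  ιℚ (p ℚ.* q)                    ≡⟨ cong (p ℚ.* q ∷_) (•-zeroʳ {7} p) ⟨
  p • ιℚ q                        ≡⟨ mulAux-∷-zeros 7 p (ιℚ q) ⟨
  ιℚ p *K ιℚ q                    ∎
  where
  p = + m ℚ./ 1
  q = + n ℚ./ 1

ιℕ-homo-^ : ∀ m n → ιℕ (m ℕ.^ n) ≡ ιℕ m ^K n
ιℕ-homo-^ m zero    = refl
ιℕ-homo-^ m (suc n) = trans (ιℕ-homo-* m (m ℕ.^ n)) (cong (ιℕ m *K_) (ιℕ-homo-^ m n))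

ιℕ-suc≢0 : ∀ n → ιℕ (suc n) ≢ 0K
ιℕ-suc≢0 n eq with ℚ.fromℚᵘ-injective {mkℚᵘ (+ suc n) 0} {mkℚᵘ (+ 0) 0} (Vec.∷-injectiveˡ eq)
... | *≡* ()

-- Matrices and their decomposition

mat-cong : ∀ {a b c d a′ b′ c′ d′} → a ≡ a′ → b ≡ b′ → c ≡ c′ → d ≡ d′ → mat a b c d ≡ mat a′ b′ c′ d′
mat-cong refl refl refl refl = refl

*M-assoc : ∀ ρ σ τ → (ρ *M σ) *M τ ≡ ρ *M (σ *M τ)
*M-assoc (mat a b c d) (mat a′ b′ c′ d′) (mat a″ b″ c″ d″) = mat-cong
  (matrix-assoc a b a′ b′ c′ d′ a″ c″) (matrix-assoc a b a′ b′ c′ d′ b″ d″)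
  (matrix-assoc c d a′ b′ c′ d′ a″ c″) (matrix-assoc c d a′ b′ c′ d′ b″ d″)

*M-identityˡ : ∀ σ → IdM *M σ ≡ σ
*M-identityˡ (mat a b c d) = mat-cong (1x+0y a c) (1x+0y b d) (0x+1y a c) (0x+1y b d)

*M-identityʳ : ∀ σ → σ *M IdM ≡ σ
*M-identityʳ (mat a b c d) = mat-cong (x1+y0 a b) (x0+y1 a b) (x1+y0 c d) (x0+y1 c d)

infixr 8 _^M_
_^M_ : Mat → ℕ → Mat
σ ^M zero  = IdM
σ ^M suc n = σ *M (σ ^M n)

diag : K → K → Mat
diag u v = mat u 0K 0K v

-- Written entrywise rather than as a product with a diagonal matrix, so that the first row, all
-- that φ sees, can be read off by computation. The same holds for `twist`, which leaves that row
-- alone.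
scale : K → Mat → Mat
scale u (mat a b c d) = mat (u *K a) (u *K b) (u *K c) (u *K d)

twist : K → Mat → Mat
twist w (mat a b c d) = mat a b (w *K c) (w *K d)

scale-diag : ∀ u σ → diag u u *M σ ≡ scale u σ
scale-diag u (mat a b c d) = mat-cong (x+0y _ c) (x+0y _ d) (0x+y a _) (0x+y b _)

twist-diag : ∀ w σ → diag 1K w *M σ ≡ twist w σ
twist-diag w (mat a b c d) = mat-cong (1x+0y a c) (1x+0y b d) (0x+y a _) (0x+y b _)

expand : List K → List K → List Mat → List Mat
expand U W B = cartesianProductWith scale U (cartesianProductWith twist W B)

expand⁻ : ∀ {U W B} (P : Mat → Set) → (∀ {σ τ} → P σ → P τ → P (σ *M τ)) →
  All (λ u → P (diag u u)) U → All (λ w → P (diag 1K w)) W → All P B → ∀ {σ} → σ ∈ expand U W B → P σ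
expand⁻ {U} {W} {B} P P-* PU PW PB σ∈
  with u , _ , u∈ , σ∈′ , refl ← ∈-cartesianProductWith⁻ scale U _ σ∈
  with w , β , w∈ , β∈ , refl ← ∈-cartesianProductWith⁻ twist W B σ∈′
  = subst P (scale-diag u _) (P-* (All.lookup PU u∈)
      (subst P (twist-diag w β) (P-* (All.lookup PW w∈) (All.lookup PB β∈))))

-- Recognising a generated group from a list

module Closure (L : List Mat) where

  Stable : Mat → Set
  Stable σ = ∀ {τ} → τ ∈ L → σ *M τ ∈ L

  -- Asking for a stable left inverse settles the constructor inv: in σ τ = 1 the matrix τ is that left inverse.
  Invertible : Mat → Set
  Invertible σ = Stable σ × ∃ λ σ′ → Stable σ′ × σ′ *M σ ≡ IdM

  Stable-* : ∀ σ τ → Stable σ → Stable τ → Stable (σ *M τ)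
  Stable-* σ τ s t {ρ} ρ∈ = subst (_∈ L) (sym (*M-assoc σ τ ρ)) (s (t ρ∈))

  Stable-Id : Stable IdM
  Stable-Id {τ} = subst (_∈ L) (sym (*M-identityˡ τ))

  Stable-^ : ∀ σ n → Stable σ → Stable (σ ^M n)
  Stable-^ σ zero    s = Stable-Id
  Stable-^ σ (suc n) s = Stable-* σ (σ ^M n) s (Stable-^ σ n s)

  finiteOrder⇒Invertible : ∀ σ n → Stable σ → (σ ^M n) *M σ ≡ IdM → Invertible σ
  finiteOrder⇒Invertible σ n s σⁿσ = s , σ ^M n , Stable-^ σ n s , σⁿσ

  Gen⇒Invertible : ∀ {g h} → Invertible g → Invertible h → ∀ {σ} → Gen g h σ → Invertible σ
  Gen⇒Invertible ig ih gen₁ = ig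
  Gen⇒Invertible ig ih gen₂ = ih
  Gen⇒Invertible ig ih one = Stable-Id , IdM , Stable-Id , refl
  Gen⇒Invertible ig ih (mul {σ} {τ} p q)
    with s , σ′ , s′ , σ′σ ← Gen⇒Invertible ig ih p
    with t , τ′ , t′ , τ′τ ← Gen⇒Invertible ig ih q
    = Stable-* σ τ s t , τ′ *M σ′ , Stable-* τ′ σ′ t′ s′ , (begin
      (τ′ *M σ′) *M (σ *M τ)  ≡⟨ *M-assoc τ′ σ′ (σ *M τ) ⟩
      τ′ *M (σ′ *M (σ *M τ))  ≡⟨ cong (τ′ *M_) (*M-assoc σ′ σ τ) ⟨
      τ′ *M ((σ′ *M σ) *M τ)  ≡⟨ cong (λ ρ → τ′ *M (ρ *M τ)) σ′σ ⟩
      τ′ *M (IdM *M τ)        ≡⟨ cong (τ′ *M_) (*M-identityˡ τ) ⟩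
      τ′ *M τ                 ≡⟨ τ′τ ⟩
      IdM                     ∎)
  Gen⇒Invertible ig ih (inv {σ} {τ} p στ)
    with s , σ′ , s′ , σ′σ ← Gen⇒Invertible ig ih p
    = subst Stable σ′≡τ s′ , σ , s , στ
    where
    σ′≡τ : σ′ ≡ τ
    σ′≡τ = begin
      σ′                ≡⟨ *M-identityʳ σ′ ⟨
      σ′ *M IdM         ≡⟨ cong (σ′ *M_) στ ⟨
      σ′ *M (σ *M τ)    ≡⟨ *M-assoc σ′ σ τ ⟨
      (σ′ *M σ) *M τ    ≡⟨ cong (_*M τ) σ′σ ⟩
      IdM *M τ          ≡⟨ *M-identityˡ τ ⟩
      τ                 ∎

  -- Let σ act on the member `IdM`: stability puts the product, which is σ, into `L`.
  Gen⇒∈ : ∀ {g h} → IdM ∈ L → Invertible g → Invertible h → ∀ {σ} → Gen g h σ → σ ∈ L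
  Gen⇒∈ id∈ ig ih {σ} p = subst (_∈ L) (*M-identityʳ σ) (proj₁ (Gen⇒Invertible ig ih p) id∈)

-- Sums over lists and independence of the enumeration

sumK-map-*ˡ : ∀ {A : Set} c (f : A → K) xs → sumK (List.map (λ x → c *K f x) xs) ≡ c *K sumK (List.map f xs)
sumK-map-*ˡ c f []       = sym (KS.zeroʳ c)
sumK-map-*ˡ c f (x ∷ xs) = trans (cong (c *K f x +K_) (sumK-map-*ˡ c f xs)) (sym (KS.distribˡ c _ _))

sumK-++ : ∀ xs ys → sumK (xs ++ ys) ≡ sumK xs +K sumK ys
sumK-++ []       ys = sym (+K-identityˡ (sumK ys))
sumK-++ (x ∷ xs) ys = trans (cong (x +K_) (sumK-++ xs ys)) (sym (+K-assoc x _ _))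

sumK-cartesianProductWith : ∀ {A B C : Set} (F : C → K) (g : A → B → C) p q →
  (∀ x y → F (g x y) ≡ p x *K q y) → ∀ xs ys →
  sumK (List.map F (cartesianProductWith g xs ys)) ≡ sumK (List.map p xs) *K sumK (List.map q ys)
sumK-cartesianProductWith F g p q F-g []       ys = sym (KS.zeroˡ (sumK (List.map q ys)))
sumK-cartesianProductWith F g p q F-g (x ∷ xs) ys = begin
  sumK (List.map F (List.map (g x) ys ++ cartesianProductWith g xs ys))
    ≡⟨ cong sumK (List.map-++ F (List.map (g x) ys) _) ⟩
  sumK (List.map F (List.map (g x) ys) ++ List.map F (cartesianProductWith g xs ys))
    ≡⟨ sumK-++ (List.map F (List.map (g x) ys)) _ ⟩
  sumK (List.map F (List.map (g x) ys)) +K sumK (List.map F (cartesianProductWith g xs ys))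
    ≡⟨ cong₂ _+K_
         (trans (cong sumK (trans (sym (List.map-∘ ys)) (List.map-cong (F-g x) ys))) (sumK-map-*ˡ (p x) q ys))
         (sumK-cartesianProductWith F g p q F-g xs ys) ⟩
  p x *K sumK (List.map q ys) +K sumK (List.map p xs) *K sumK (List.map q ys)
    ≡⟨ KS.distribʳ _ (p x) _ ⟨
  (p x +K sumK (List.map p xs)) *K sumK (List.map q ys) ∎

sumK-↭ : ∀ {xs ys} → xs ↭ ys → sumK xs ≡ sumK ys
sumK-↭ Perm.refl = refl
sumK-↭ (Perm.prep x p) = cong (x +K_) (sumK-↭ p)
sumK-↭ (Perm.swap x y p) = trans (cong (λ z → x +K (y +K z)) (sumK-↭ p))
  (trans (sym (+K-assoc x y _)) (trans (cong (_+K _) (+K-comm x y)) (+K-assoc y x _)))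
sumK-↭ (Perm.trans p q) = trans (sumK-↭ p) (sumK-↭ q)

invLength-cong : ∀ L L′ → length L ≡ length L′ → invLength L ≡ invLength L′
invLength-cong []       []       eq = refl
invLength-cong (_ ∷ xs) (_ ∷ ys) eq = cong (λ n → + 1 ℚ./ suc n) (ℕ.suc-injective eq)

-- Two lists without repetition that have the same members agree as multisets, so each is a
-- permutation of the other. The theorem therefore needs proof for only one list per group.
phiCoeff-unique : ∀ {L L′ G} → Enumerates L G → Enumerates L′ G → ∀ ℓ j → phiCoeff L ℓ j ≡ phiCoeff L′ ℓ j
phiCoeff-unique {L} {L′} (L! , L⇔) (L′! , L′⇔) ℓ j =
  cong₂ _•_ (invLength-cong L L′ (↭-length L↭L′)) (sumK-↭ (map⁺ _ L↭L′))
  where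
  L↭L′ : L ↭ L′
  L↭L′ = ∼bag⇒↭ (unique∧set⇒bag L! L′! (λ {σ} → ⇔-trans (L⇔ σ) (⇔-sym (L′⇔ σ))))

-- The coefficients of φ_ℓ

powerSum : List K → ℕ → K
powerSum U k = sumK (List.map (_^K k) U)

monomial : K → ℕ → ℕ → Mat → K
monomial c ℓ j σ = c *K (Mat.a σ ^K (ℓ ℕ.∸ j)) *K (Mat.b σ ^K j)

^K-∸-+ : ∀ x {ℓ j} → j ℕ.≤ ℓ → x ^K (ℓ ℕ.∸ j) *K x ^K j ≡ x ^K ℓ
^K-∸-+ x {ℓ} {j} j≤ℓ = trans (sym (^K-+ x (ℓ ℕ.∸ j) j)) (cong (x ^K_) (ℕ.m∸n+n≡m j≤ℓ))

-- Homogeneity: u occurs with the exponents ℓ - j and j, which add up to ℓ because `j ≤ ℓ` keeps the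
-- truncated subtraction exact.
monomial-scale : ∀ c {ℓ j} → j ℕ.≤ ℓ → ∀ u σ → monomial c ℓ j (scale u σ) ≡ u ^K ℓ *K monomial c ℓ j σ
monomial-scale c {ℓ} {j} j≤ℓ u (mat a b _ _) = begin
  c *K ((u *K a) ^K (ℓ ℕ.∸ j)) *K ((u *K b) ^K j)
    ≡⟨ cong₂ (λ x y → c *K x *K y) (*K-^K u a (ℓ ℕ.∸ j)) (*K-^K u b j) ⟩
  c *K (u ^K (ℓ ℕ.∸ j) *K a ^K (ℓ ℕ.∸ j)) *K (u ^K j *K b ^K j)
    ≡⟨ pull-factors c (u ^K (ℓ ℕ.∸ j)) (a ^K (ℓ ℕ.∸ j)) (u ^K j) (b ^K j) ⟩
  (u ^K (ℓ ℕ.∸ j) *K u ^K j) *K (c *K a ^K (ℓ ℕ.∸ j) *K b ^K j)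
    ≡⟨ cong (_*K _) (^K-∸-+ u j≤ℓ) ⟩
  u ^K ℓ *K (c *K a ^K (ℓ ℕ.∸ j) *K b ^K j) ∎

monomialSum-expand : ∀ c {ℓ j} → j ℕ.≤ ℓ → ∀ U W B →
  sumK (List.map (monomial c ℓ j) (expand U W B)) ≡
  powerSum U ℓ *K (powerSum W 0 *K sumK (List.map (monomial c ℓ j) B))
monomialSum-expand c {ℓ} {j} j≤ℓ U W B = trans
  (sumK-cartesianProductWith (monomial c ℓ j) scale (_^K ℓ) (monomial c ℓ j) (monomial-scale c j≤ℓ)
    U (cartesianProductWith twist W B))
  (cong (powerSum U ℓ *K_)
    -- As `twist` preserves the first row, its factor is 1. Writing it as `w ^K 0` brings it into
    -- product form, and `powerSum W 0` counts the elements of `W`.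
    (sumK-cartesianProductWith (monomial c ℓ j) twist (_^K 0) (monomial c ℓ j)
      (λ { _ (mat _ _ _ _) → sym (KS.*-identityˡ _) }) W B))

-- The product H·diag(1, w), where H is s times the matrix with rows (1, t) and (1, -1).
rootMatrix : K → K → K → Mat
rootMatrix s t w = mat s (s *K (t *K w)) s ((ℚ.- 1ℚ) • (s *K w))

rootMatrices : K → K → List K → List Mat
rootMatrices s t = List.map (rootMatrix s t)

monomialSum-rootMatrices : ∀ c s t {ℓ j} → j ℕ.≤ ℓ → ∀ W →
  sumK (List.map (monomial c ℓ j) (rootMatrices s t W)) ≡ c *K (s ^K ℓ *K t ^K j) *K powerSum W j
monomialSum-rootMatrices c s t {ℓ} {j} j≤ℓ W = begin
  sumK (List.map (monomial c ℓ j) (rootMatrices s t W))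
    ≡⟨ cong sumK (trans (sym (List.map-∘ W)) (List.map-cong term W)) ⟩
  sumK (List.map (λ w → c *K (s ^K ℓ *K t ^K j) *K w ^K j) W)
    ≡⟨ sumK-map-*ˡ (c *K (s ^K ℓ *K t ^K j)) (_^K j) W ⟩
  c *K (s ^K ℓ *K t ^K j) *K powerSum W j ∎
  where
  term : ∀ w → c *K s ^K (ℓ ℕ.∸ j) *K (s *K (t *K w)) ^K j ≡ c *K (s ^K ℓ *K t ^K j) *K w ^K j
  term w = begin
    c *K s ^K (ℓ ℕ.∸ j) *K (s *K (t *K w)) ^K j
      ≡⟨ cong (c *K s ^K (ℓ ℕ.∸ j) *K_) (trans (*K-^K s (t *K w) j) (cong (s ^K j *K_) (*K-^K t w j))) ⟩
    c *K s ^K (ℓ ℕ.∸ j) *K (s ^K j *K (t ^K j *K w ^K j))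
      ≡⟨ pull-line c _ _ _ _ ⟩
    c *K ((s ^K (ℓ ℕ.∸ j) *K s ^K j) *K t ^K j) *K w ^K j
      ≡⟨ cong (λ x → c *K (x *K t ^K j) *K w ^K j) (^K-∸-+ s j≤ℓ) ⟩
    c *K (s ^K ℓ *K t ^K j) *K w ^K j ∎

-- Finitely many conditions that can be checked by evaluation: power sums of n-th roots of unity are
-- periodic in the exponent, so the exponents below n determine the rest.
record PowerSums (n : ℕ) (U : List K) : Set where
  field
    roots     : All (λ u → u ^K n ≡ 1K) U
    full      : powerSum U 0 ≡ ιℕ n
    vanishing : ∀ k → k ≢ 0 → k ℕ.< n → powerSum U k ≡ 0K

powerSum-% : ∀ n .{{_ : ℕ.NonZero n}} {U} → All (λ u → u ^K n ≡ 1K) U → ∀ k → powerSum U k ≡ powerSum U (k % n)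
powerSum-% n []                k = refl
powerSum-% n (_∷_ {u} uⁿ≡1 us) k = cong₂ _+K_ reduce (powerSum-% n us k)
  where
  reduce : u ^K k ≡ u ^K (k % n)
  reduce = begin
    u ^K k
      ≡⟨ cong (u ^K_) (m≡m%n+[m/n]*n k n) ⟩
    u ^K (k % n ℕ.+ (k / n) ℕ.* n)
      ≡⟨ ^K-+ u (k % n) _ ⟩
    u ^K (k % n) *K u ^K ((k / n) ℕ.* n)
      ≡⟨ cong (u ^K (k % n) *K_) (trans (^K-* u (k / n) n)
           (trans (cong (_^K (k / n)) uⁿ≡1) (1K-^K (k / n)))) ⟩
    u ^K (k % n) *K 1K
      ≡⟨ *K-identityʳ _ ⟩
    u ^K (k % n) ∎

powerSum-∣ : ∀ {n} .{{_ : ℕ.NonZero n}} {U} → PowerSums n U → ∀ {k} → n ∣ k → powerSum U k ≡ ιℕ n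
powerSum-∣ {n} {U} P {k} n∣k = begin
  powerSum U k        ≡⟨ powerSum-% n (PowerSums.roots P) k ⟩
  powerSum U (k % n)  ≡⟨ cong (powerSum U) (n∣m⇒m%n≡0 k n n∣k) ⟩
  powerSum U 0        ≡⟨ PowerSums.full P ⟩
  ιℕ n                ∎

powerSum-∤ : ∀ {n} .{{_ : ℕ.NonZero n}} {U} → PowerSums n U → ∀ {k} → ¬ n ∣ k → powerSum U k ≡ 0K
powerSum-∤ {n} {U} P {k} n∤k = begin
  powerSum U k        ≡⟨ powerSum-% n (PowerSums.roots P) k ⟩
  powerSum U (k % n)  ≡⟨ PowerSums.vanishing P (k % n) (λ k%n≡0 → n∤k (m%n≡0⇒n∣m k n k%n≡0)) (m%n<n k n) ⟩
  0K                  ∎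

phiCoeff-expand : ∀ U W B {ℓ j} → j ℕ.≤ ℓ → phiCoeff (expand U W B) ℓ j ≡
  (invLength (expand U W B) • (powerSum U ℓ *K powerSum W 0)) *K sumK (List.map (monomial (ιℕ (ℓ C j)) ℓ j) B)
phiCoeff-expand U W B {ℓ} {j} j≤ℓ = begin
  c • sumK (List.map (monomial (ιℕ (ℓ C j)) ℓ j) (expand U W B))
    ≡⟨ cong (c •_) (monomialSum-expand (ιℕ (ℓ C j)) j≤ℓ U W B) ⟩
  c • (powerSum U ℓ *K (powerSum W 0 *K X))
    ≡⟨ cong (c •_) (KS.*-assoc (powerSum U ℓ) (powerSum W 0) X) ⟨
  c • ((powerSum U ℓ *K powerSum W 0) *K X)
    ≡⟨ mulAux-•ˡ c (powerSum U ℓ *K powerSum W 0) X ⟨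
  (c • (powerSum U ℓ *K powerSum W 0)) *K X ∎
  where
  c = invLength (expand U W B)
  X = sumK (List.map (monomial (ιℕ (ℓ C j)) ℓ j) B)

phiZero-expand : ∀ {m} .{{_ : ℕ.NonZero m}} U W B → PowerSums m U → ∀ {ℓ} → ¬ m ∣ ℓ → PhiZero (expand U W B) ℓ
phiZero-expand U W B P {ℓ} m∤ℓ j j≤ℓ = begin
  phiCoeff (expand U W B) ℓ j
    ≡⟨ phiCoeff-expand U W B j≤ℓ ⟩
  (c • (powerSum U ℓ *K powerSum W 0)) *K X
    ≡⟨ cong (λ p → (c • (p *K powerSum W 0)) *K X) (powerSum-∤ P m∤ℓ) ⟩
  (c • (0K *K powerSum W 0)) *K X
    ≡⟨ cong (λ p → (c • p) *K X) (KS.zeroˡ (powerSum W 0)) ⟩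
  (c • 0K) *K X
    ≡⟨ cong (_*K X) (•-zeroʳ {8} c) ⟩
  0K *K X
    ≡⟨ KS.zeroˡ X ⟩
  0K ∎
  where
  c = invLength (expand U W B)
  X = sumK (List.map (monomial (ιℕ (ℓ C j)) ℓ j) B)

-- All coefficients share the factor γσ, so the cross-multiplied ratios agree by rearrangement. The
-- supplied inverses of γ and σ recover D from the leading coefficient γσD, which is therefore
-- nonzero.
normalisedIs : ∀ L ℓ {γ γ′ σ ρ D} N (X : ℕ → K) →
  (∀ j → j ℕ.≤ ℓ → phiCoeff L ℓ j ≡ γ *K X j) → (∀ j → j ℕ.≤ ℓ → X j ≡ σ *K N j) →
  N 0 ≡ D → γ *K γ′ ≡ 1K → σ *K ρ ≡ 1K → D ≢ 0K → NormalisedIs L ℓ D N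
normalisedIs L ℓ {γ} {γ′} {σ} {ρ} {D} N X φ≡ X≡ N0≡D γγ′ σρ D≢0 = c₀≢0 , ratios
  where
  φ : ∀ j → j ℕ.≤ ℓ → phiCoeff L ℓ j ≡ γ *K (σ *K N j)
  φ j j≤ℓ = trans (φ≡ j j≤ℓ) (cong (γ *K_) (X≡ j j≤ℓ))
  φ₀ : phiCoeff L ℓ 0 ≡ γ *K (σ *K D)
  φ₀ = trans (φ 0 z≤n) (cong (λ n → γ *K (σ *K n)) N0≡D)
  ratios : ∀ j → j ℕ.≤ ℓ → phiCoeff L ℓ j *K D ≡ phiCoeff L ℓ 0 *K N j
  ratios j j≤ℓ = begin
    phiCoeff L ℓ j *K D         ≡⟨ cong (_*K D) (φ j j≤ℓ) ⟩
    (γ *K (σ *K N j)) *K D      ≡⟨ ratio γ σ (N j) D ⟩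
    (γ *K (σ *K D)) *K N j      ≡⟨ cong (_*K N j) φ₀ ⟨
    phiCoeff L ℓ 0 *K N j       ∎
  c₀≢0 : phiCoeff L ℓ 0 ≢ 0K
  c₀≢0 c₀≡0 = D≢0 (begin
    D                                  ≡⟨ KS.*-identityˡ D ⟨
    1K *K D                            ≡⟨ cong (_*K D) σρ ⟨
    (σ *K ρ) *K D                      ≡⟨ KS.*-identityˡ _ ⟨
    1K *K ((σ *K ρ) *K D)              ≡⟨ cong (_*K ((σ *K ρ) *K D)) γγ′ ⟨
    (γ *K γ′) *K ((σ *K ρ) *K D)       ≡⟨ cancel-units γ γ′ σ ρ D ⟨
    (γ *K (σ *K D)) *K (γ′ *K ρ)       ≡⟨ cong (_*K (γ′ *K ρ)) (trans (sym φ₀) c₀≡0) ⟩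
    0K *K (γ′ *K ρ)                    ≡⟨ KS.zeroˡ (γ′ *K ρ) ⟩
    0K                                 ∎)

nC0≡1 : ∀ n → n C 0 ≡ 1
nC0≡1 n = trans (nCk≡nC[n∸k] {0} {n} z≤n) (nCn≡1 n)

0K^-nonzero : ∀ {k} → k ≢ 0 → 0K ^K k ≡ 0K
0K^-nonzero {zero} k≢0 = ⊥-elim (k≢0 refl)
0K^-nonzero {suc k} _ = KS.zeroˡ (0K ^K k)

Den : ℕ → K → ℕ → K
Den n r ℓ = ιℕ n +K r ^K ℓ

-- Positivity of √2 or √3 is not expressible in `K`. With ℓ = q·d, however, r^ℓ equals ρ^q, and the
-- denominator becomes a positive integer.
Den≢0 : ∀ n r d ρ {ℓ} → r ^K d ≡ ιℕ ρ → d ∣ ℓ → Den (suc n) r ℓ ≢ 0K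
Den≢0 n r d ρ rᵈ≡ρ (divides q refl) D≡0 = ιℕ-suc≢0 (n ℕ.+ ρ ℕ.^ q) (begin
  ιℕ (suc n ℕ.+ ρ ℕ.^ q)          ≡⟨ ιℕ-homo-+ (suc n) (ρ ℕ.^ q) ⟩
  ιℕ (suc n) +K ιℕ (ρ ℕ.^ q)      ≡⟨ cong (ιℕ (suc n) +K_) (ιℕ-homo-^ ρ q) ⟩
  ιℕ (suc n) +K ιℕ ρ ^K q         ≡⟨ cong (λ x → ιℕ (suc n) +K x ^K q) rᵈ≡ρ ⟨
  ιℕ (suc n) +K (r ^K d) ^K q     ≡⟨ cong (ιℕ (suc n) +K_) (^K-* r q d) ⟨
  ιℕ (suc n) +K r ^K (q ℕ.* d)    ≡⟨ D≡0 ⟩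
  0K                              ∎)

powers-inverse : ∀ s r → s *K r ≡ 1K → ∀ ℓ → s ^K ℓ *K r ^K ℓ ≡ 1K
powers-inverse s r sr ℓ = trans (sym (*K-^K s r ℓ)) (trans (cong (_^K ℓ) sr) (1K-^K ℓ))

-- Normalised coefficients

module Lines (n t : ℕ) .{{_ : ℕ.NonZero n}} (s r : K) (W : List K) (PW : PowerSums n W) (sr : s *K r ≡ 1K) where

  lines : ℕ → ℕ → K
  lines ℓ j = sumK (List.map (monomial (ιℕ (ℓ C j)) ℓ j) (rootMatrices s (ιℕ t) W))

  lines-leading : ∀ ℓ → 1K +K lines ℓ 0 ≡ s ^K ℓ *K Den n r ℓ
  lines-leading ℓ = begin
    1K +K lines ℓ 0
      ≡⟨ cong (1K +K_) (monomialSum-rootMatrices (ιℕ (ℓ C 0)) s (ιℕ t) {ℓ} z≤n W) ⟩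
    1K +K ιℕ (ℓ C 0) *K (s ^K ℓ *K 1K) *K powerSum W 0
      ≡⟨ cong₂ (λ c p → 1K +K ιℕ c *K (s ^K ℓ *K 1K) *K p) (nC0≡1 ℓ) (PowerSums.full PW) ⟩
    1K +K 1K *K (s ^K ℓ *K 1K) *K ιℕ n
      -- The contribution 1 of the identity matrix is rewritten as s^ℓ r^ℓ so that s^ℓ can be
      -- factored out.
      ≡⟨ cong (_+K 1K *K (s ^K ℓ *K 1K) *K ιℕ n) (powers-inverse s r sr ℓ) ⟨
    s ^K ℓ *K r ^K ℓ +K 1K *K (s ^K ℓ *K 1K) *K ιℕ n
      ≡⟨ leading (s ^K ℓ) (r ^K ℓ) (ιℕ n) ⟩
    s ^K ℓ *K Den n r ℓ ∎

  lines-∣ : ∀ {ℓ j} → j ℕ.≤ ℓ → n ∣ j → lines ℓ j ≡ s ^K ℓ *K (ιℕ n *K ιℕ (t ℕ.^ j) *K ιℕ (ℓ C j))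
  lines-∣ {ℓ} {j} j≤ℓ n∣j = begin
    lines ℓ j
      ≡⟨ monomialSum-rootMatrices (ιℕ (ℓ C j)) s (ιℕ t) j≤ℓ W ⟩
    ιℕ (ℓ C j) *K (s ^K ℓ *K ιℕ t ^K j) *K powerSum W j
      ≡⟨ cong₂ (λ x p → ιℕ (ℓ C j) *K (s ^K ℓ *K x) *K p) (sym (ιℕ-homo-^ t j)) (powerSum-∣ PW n∣j) ⟩
    ιℕ (ℓ C j) *K (s ^K ℓ *K ιℕ (t ℕ.^ j)) *K ιℕ n
      ≡⟨ middle (ιℕ (ℓ C j)) (s ^K ℓ) (ιℕ (t ℕ.^ j)) (ιℕ n) ⟩
    s ^K ℓ *K (ιℕ n *K ιℕ (t ℕ.^ j) *K ιℕ (ℓ C j)) ∎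

  -- The zero keeps the factor `s ^K ℓ` in order to match the other cases of `select` and `select₃`.
  lines-∤ : ∀ {ℓ j} → j ℕ.≤ ℓ → ¬ n ∣ j → lines ℓ j ≡ s ^K ℓ *K 0K
  lines-∤ {ℓ} {j} j≤ℓ n∤j = begin
    lines ℓ j
      ≡⟨ monomialSum-rootMatrices (ιℕ (ℓ C j)) s (ιℕ t) j≤ℓ W ⟩
    ιℕ (ℓ C j) *K (s ^K ℓ *K ιℕ t ^K j) *K powerSum W j
      ≡⟨ cong (ιℕ (ℓ C j) *K (s ^K ℓ *K ιℕ t ^K j) *K_) (powerSum-∤ PW n∤j) ⟩
    ιℕ (ℓ C j) *K (s ^K ℓ *K ιℕ t ^K j) *K 0K
      ≡⟨ KS.zeroʳ (ιℕ (ℓ C j) *K (s ^K ℓ *K ιℕ t ^K j)) ⟩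
    0K
      ≡⟨ KS.zeroʳ (s ^K ℓ) ⟨
    s ^K ℓ *K 0K ∎

-- The element of type I that accounts for the term y^ℓ.
swapM : Mat
swapM = mat 0K 1K 1K 0K

-- The entry 0 of the first row has exponent 0 here, and `0K ^K 0` is `1K` by definition;
-- `monomial-swap-ℓ` relies on the same convention.
monomial-Id-0 : ∀ ℓ → monomial (ιℕ (ℓ C 0)) ℓ 0 IdM ≡ 1K
monomial-Id-0 ℓ = cong₂ (λ c x → ιℕ c *K x *K 1K) (nC0≡1 ℓ) (1K-^K ℓ)

monomial-Id-suc : ∀ c ℓ j → monomial c ℓ (suc j) IdM ≡ 0K
monomial-Id-suc c ℓ j = trans (cong (c *K 1K ^K (ℓ ℕ.∸ suc j) *K_) (KS.zeroˡ (0K ^K j)))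
  (KS.zeroʳ (c *K 1K ^K (ℓ ℕ.∸ suc j)))

monomial-swap-< : ∀ c {ℓ j} → j ℕ.< ℓ → monomial c ℓ j swapM ≡ 0K
monomial-swap-< c {ℓ} {j} j<ℓ = begin
  c *K 0K ^K (ℓ ℕ.∸ j) *K 1K ^K j   ≡⟨ cong (λ x → c *K x *K 1K ^K j) (0K^-nonzero (ℕ.m>n⇒m∸n≢0 j<ℓ)) ⟩
  c *K 0K *K 1K ^K j                ≡⟨ cong (_*K 1K ^K j) (KS.zeroʳ c) ⟩
  0K *K 1K ^K j                     ≡⟨ KS.zeroˡ (1K ^K j) ⟩
  0K                                ∎

monomial-swap-ℓ : ∀ ℓ → monomial (ιℕ (ℓ C ℓ)) ℓ ℓ swapM ≡ 1K
monomial-swap-ℓ ℓ = begin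
  ιℕ (ℓ C ℓ) *K 0K ^K (ℓ ℕ.∸ ℓ) *K 1K ^K ℓ
    ≡⟨ cong₂ (λ c k → ιℕ c *K 0K ^K k *K 1K ^K ℓ) (nCn≡1 ℓ) (ℕ.n∸n≡0 ℓ) ⟩
  1K *K 1K *K 1K ^K ℓ
    ≡⟨ cong (1K *K 1K *K_) (1K-^K ℓ) ⟩
  1K ∎

-- Splitting on the decisions makes the conditional in the numerator reduce. The summand `0K` is
-- what its clause for j = 0 leaves behind at a positive j.
select : ∀ {P Q : Set} {x y} σ (p? : Dec P) (q? : Dec Q) → P →
  (Q → x ≡ σ *K y) → (¬ Q → x ≡ σ *K 0K) → x ≡ σ *K (0K +K (if ⌊ p? ⌋ ∧ ⌊ q? ⌋ then y else 0K))
select σ (no ¬p) _ p _ _ = ⊥-elim (¬p p)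
select {y = y} σ (yes _) (yes q) _ on _ = trans (on q) (cong (σ *K_) (sym (+K-identityˡ y)))
select σ (yes _) (no ¬q) _ _ off = trans (off ¬q) (cong (σ *K_) (sym (+K-identityˡ 0K)))

module Ratio {m n : ℕ} .{{_ : ℕ.NonZero m}} .{{_ : ℕ.NonZero n}} {t : ℕ} {s r : K} {U W : List K} {γ′ : K} {d ρ : ℕ}
             (PU : PowerSums m U) (PW : PowerSums n W) (sr : s *K r ≡ 1K) (rᵈ≡ρ : r ^K d ≡ ιℕ ρ) where

  open Lines n t s r W PW sr public

  normalisedIs-expand : ∀ M → let B = M ++ rootMatrices s (ιℕ t) W in
    (invLength (expand U W B) • (ιℕ m *K ιℕ n)) *K γ′ ≡ 1K →
    ∀ {ℓ} → m ∣ ℓ → d ∣ ℓ → ∀ N → N 0 ≡ Den n r ℓ →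
    (∀ j → j ℕ.≤ ℓ → sumK (List.map (monomial (ιℕ (ℓ C j)) ℓ j) B) ≡ s ^K ℓ *K N j) →
    NormalisedIs (expand U W B) ℓ (Den n r ℓ) N
  normalisedIs-expand M γγ′ {ℓ} m∣ℓ d∣ℓ N N₀ X≡ =
    normalisedIs (expand U W B) ℓ {invLength (expand U W B) • (ιℕ m *K ιℕ n)} {γ′} {s ^K ℓ} {r ^K ℓ} N
      (λ j → sumK (List.map (monomial (ιℕ (ℓ C j)) ℓ j) B))
      (λ j j≤ℓ → trans (phiCoeff-expand U W B j≤ℓ)
        (cong₂ (λ p q → (invLength (expand U W B) • (p *K q)) *K sumK (List.map (monomial (ιℕ (ℓ C j)) ℓ j) B))
          (powerSum-∣ PU m∣ℓ) (PowerSums.full PW)))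
      X≡ N₀ γγ′ (powers-inverse s r sr ℓ) (Den≢0′ n)
    where
    B = M ++ rootMatrices s (ιℕ t) W
    -- Quantified afresh because `n` is a parameter of the module: now it can be matched, and
    -- `NonZero` leaves only the successor.
    Den≢0′ : ∀ n .{{_ : ℕ.NonZero n}} → Den n r ℓ ≢ 0K
    Den≢0′ (suc n) = Den≢0 n r d ρ rᵈ≡ρ d∣ℓ

  -- Its instances are definitionally `NumIII` and `NumIV`, so that `X≡Num` applies to both.
  Num : ℕ → ℕ → K
  Num ℓ j =
    (if ⌊ j ℕ.≟ 0 ⌋ then Den n r ℓ else 0K) +K
    (if ⌊ 0 ℕ.<? j ⌋ ∧ ⌊ j ℕ.≤? ℓ ⌋ ∧ ⌊ n ∣? j ⌋ then ιℕ n *K ιℕ (t ℕ.^ j) *K ιℕ (ℓ C j) else 0K)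

  X≡Num : ∀ {ℓ} j → j ℕ.≤ ℓ →
    sumK (List.map (monomial (ιℕ (ℓ C j)) ℓ j) (IdM ∷ rootMatrices s (ιℕ t) W)) ≡ s ^K ℓ *K Num ℓ j
  X≡Num {ℓ} zero _ = begin
    monomial (ιℕ (ℓ C 0)) ℓ 0 IdM +K lines ℓ 0
      ≡⟨ cong (_+K lines ℓ 0) (monomial-Id-0 ℓ) ⟩
    1K +K lines ℓ 0
      ≡⟨ lines-leading ℓ ⟩
    s ^K ℓ *K Den n r ℓ
      ≡⟨ cong (s ^K ℓ *K_) (+K-identityʳ (Den n r ℓ)) ⟨
    s ^K ℓ *K Num ℓ 0 ∎
  X≡Num {ℓ} (suc j) j≤ℓ = begin
    monomial (ιℕ (ℓ C suc j)) ℓ (suc j) IdM +K lines ℓ (suc j)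
      ≡⟨ cong (_+K lines ℓ (suc j)) (monomial-Id-suc (ιℕ (ℓ C suc j)) ℓ j) ⟩
    0K +K lines ℓ (suc j)
      ≡⟨ +K-identityˡ (lines ℓ (suc j)) ⟩
    lines ℓ (suc j)
      ≡⟨ select (s ^K ℓ) (suc j ℕ.≤? ℓ) (n ∣? suc j) j≤ℓ (lines-∣ j≤ℓ) (lines-∤ j≤ℓ) ⟩
    s ^K ℓ *K Num ℓ (suc j) ∎

select₃ : ∀ {j ℓ} {Q : Set} {x D y} σ (e? : Dec (j ≡ ℓ)) (l? : Dec (j ℕ.< ℓ)) (q? : Dec Q) → j ℕ.≤ ℓ →
  (j ≡ ℓ → x ≡ σ *K D) → (j ℕ.< ℓ → Q → x ≡ σ *K y) → (j ℕ.< ℓ → ¬ Q → x ≡ σ *K 0K) →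
  x ≡ σ *K (0K +K (if ⌊ e? ⌋ then D else 0K) +K (if ⌊ l? ⌋ ∧ ⌊ q? ⌋ then y else 0K))
select₃ σ (yes refl) (yes j<j) _ _ _ _ _ = ⊥-elim (ℕ.<-irrefl refl j<j)
select₃ {D = D} σ (yes e) (no _) _ _ end _ _ =
  trans (end e) (cong (σ *K_) (sym (trans (+K-identityʳ (0K +K D)) (+K-identityˡ D))))
select₃ {y = y} σ (no _) (yes l) (yes q) _ _ on _ = trans (on l q) (cong (σ *K_) (sym (+K-identityˡ y)))
select₃ σ (no _) (yes l) (no ¬q) _ _ _ off = off l ¬q
select₃ σ (no j≢ℓ) (no j≮ℓ) _ j≤ℓ _ _ _ = ⊥-elim (j≮ℓ (ℕ.≤∧≢⇒< j≤ℓ j≢ℓ))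

module Ratio-I {s r : K} {U : List K} {γ′ : K} {d ρ : ℕ}
               (PU : PowerSums 2 U) (sr : s *K r ≡ 1K) (rᵈ≡ρ : r ^K d ≡ ιℕ ρ) where

  open Ratio {t = 1} {s} {r} {U} {U} {γ′} {d} {ρ} PU PU sr rᵈ≡ρ

  Num-I : ℕ → ℕ → K
  Num-I ℓ j =
    (if ⌊ j ℕ.≟ 0 ⌋ then Den 2 r ℓ else 0K) +K
    (if ⌊ j ℕ.≟ ℓ ⌋ then Den 2 r ℓ else 0K) +K
    (if ⌊ 0 ℕ.<? j ⌋ ∧ ⌊ j ℕ.<? ℓ ⌋ ∧ ⌊ 2 ∣? j ⌋ then ιℕ 2 *K ιℕ (ℓ C j) else 0K)

  X-I : ℕ → ℕ → K
  X-I ℓ j = sumK (List.map (monomial (ιℕ (ℓ C j)) ℓ j) (IdM ∷ swapM ∷ rootMatrices s (ιℕ 1) U))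

  lines-even : ∀ {ℓ j} → j ℕ.≤ ℓ → 2 ∣ j → lines ℓ j ≡ s ^K ℓ *K (ιℕ 2 *K ιℕ (ℓ C j))
  lines-even {ℓ} {j} j≤ℓ 2∣j = trans (lines-∣ j≤ℓ 2∣j)
    (cong (λ k → s ^K ℓ *K (ιℕ 2 *K ιℕ k *K ιℕ (ℓ C j))) (ℕ.^-zeroˡ j))

  lines-top : ∀ {ℓ} → 2 ∣ ℓ → lines ℓ ℓ ≡ lines ℓ 0
  lines-top {ℓ} 2∣ℓ = begin
    lines ℓ ℓ                               ≡⟨ lines-even {ℓ} ℕ.≤-refl 2∣ℓ ⟩
    s ^K ℓ *K (ιℕ 2 *K ιℕ (ℓ C ℓ))          ≡⟨ cong (λ c → s ^K ℓ *K (ιℕ 2 *K ιℕ c)) (trans (nCn≡1 ℓ) (sym (nC0≡1 ℓ))) ⟩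
    s ^K ℓ *K (ιℕ 2 *K ιℕ (ℓ C 0))          ≡⟨ lines-even {ℓ} z≤n (2 ∣0) ⟨
    lines ℓ 0                               ∎

  -- For positive ℓ the identity contributes only at j = 0 and the swap only at j = ℓ, while
  -- evenness of ℓ makes the remaining terms at both ends equal. At ℓ = 0 the two ends coincide and
  -- `Num-I` would count the denominator twice.
  X≡Num-I : ∀ {ℓ} → 2 ∣ ℓ → ℓ ≢ 0 → ∀ j → j ℕ.≤ ℓ → X-I ℓ j ≡ s ^K ℓ *K Num-I ℓ j
  X≡Num-I {zero}  _ ℓ≢0 _ _ = ⊥-elim (ℓ≢0 refl)
  X≡Num-I {ℓ@(suc _)} 2∣ℓ _ zero _ = begin
    monomial (ιℕ (ℓ C 0)) ℓ 0 IdM +K (monomial (ιℕ (ℓ C 0)) ℓ 0 swapM +K lines ℓ 0)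
      ≡⟨ cong₂ (λ x y → x +K (y +K lines ℓ 0)) (monomial-Id-0 ℓ) (monomial-swap-< (ιℕ (ℓ C 0)) {ℓ} {0} (s≤s z≤n)) ⟩
    1K +K (0K +K lines ℓ 0)
      ≡⟨ cong (1K +K_) (+K-identityˡ (lines ℓ 0)) ⟩
    1K +K lines ℓ 0
      ≡⟨ lines-leading ℓ ⟩
    s ^K ℓ *K Den 2 r ℓ
      ≡⟨ cong (s ^K ℓ *K_) (trans (+K-identityʳ (Den 2 r ℓ +K 0K)) (+K-identityʳ (Den 2 r ℓ))) ⟨
    s ^K ℓ *K Num-I ℓ 0 ∎
  X≡Num-I {ℓ@(suc _)} 2∣ℓ _ (suc k) j≤ℓ = begin
    monomial c ℓ j IdM +K (monomial c ℓ j swapM +K lines ℓ j)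
      ≡⟨ cong (_+K (monomial c ℓ j swapM +K lines ℓ j)) (monomial-Id-suc c ℓ k) ⟩
    0K +K (monomial c ℓ j swapM +K lines ℓ j)
      ≡⟨ +K-identityˡ (monomial c ℓ j swapM +K lines ℓ j) ⟩
    monomial c ℓ j swapM +K lines ℓ j
      ≡⟨ select₃ (s ^K ℓ) (j ℕ.≟ ℓ) (j ℕ.<? ℓ) (2 ∣? j) j≤ℓ end
           (λ j<ℓ 2∣j → trans (inner j<ℓ) (lines-even j≤ℓ 2∣j))
           (λ j<ℓ 2∤j → trans (inner j<ℓ) (lines-∤ j≤ℓ 2∤j)) ⟩
    s ^K ℓ *K Num-I ℓ j ∎
    where
    j = suc k
    c = ιℕ (ℓ C j)
    inner : j ℕ.< ℓ → monomial c ℓ j swapM +K lines ℓ j ≡ lines ℓ j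
    inner j<ℓ = trans (cong (_+K lines ℓ j) (monomial-swap-< c j<ℓ)) (+K-identityˡ (lines ℓ j))
    top : monomial (ιℕ (ℓ C ℓ)) ℓ ℓ swapM +K lines ℓ ℓ ≡ s ^K ℓ *K Den 2 r ℓ
    top = trans (cong₂ _+K_ (monomial-swap-ℓ ℓ) (lines-top 2∣ℓ)) (lines-leading ℓ)
    end : j ≡ ℓ → monomial c ℓ j swapM +K lines ℓ j ≡ s ^K ℓ *K Den 2 r ℓ
    end j≡ℓ = trans (cong (λ j → monomial (ιℕ (ℓ C j)) ℓ j swapM +K lines ℓ j) j≡ℓ) top

  Num-I-0 : ∀ {ℓ} → ℓ ≢ 0 → Num-I ℓ 0 ≡ Den 2 r ℓ
  Num-I-0 {zero}  ℓ≢0 = ⊥-elim (ℓ≢0 refl)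
  Num-I-0 {ℓ@(suc _)} _ = trans (+K-identityʳ (Den 2 r ℓ +K 0K)) (+K-identityʳ (Den 2 r ℓ))

  normalised-I : (invLength (expand U U (IdM ∷ swapM ∷ rootMatrices s (ιℕ 1) U)) • (ιℕ 2 *K ιℕ 2)) *K γ′ ≡ 1K →
    ∀ {ℓ} → 2 ∣ ℓ → d ∣ ℓ → ℓ ≢ 0 →
    NormalisedIs (expand U U (IdM ∷ swapM ∷ rootMatrices s (ιℕ 1) U)) ℓ (Den 2 r ℓ) (Num-I ℓ)
  normalised-I γγ′ {ℓ} 2∣ℓ d∣ℓ ℓ≢0 =
    normalisedIs-expand (IdM ∷ swapM ∷ []) γγ′ 2∣ℓ d∣ℓ (Num-I ℓ) (Num-I-0 ℓ≢0) (X≡Num-I 2∣ℓ ℓ≢0)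

phiZero-cong : ∀ {L L′ ℓ} → (∀ j → phiCoeff L ℓ j ≡ phiCoeff L′ ℓ j) → PhiZero L′ ℓ → PhiZero L ℓ
phiZero-cong φ≡ zeros j j≤ℓ = trans (φ≡ j) (zeros j j≤ℓ)

normalisedIs-cong : ∀ {L L′ ℓ D N} → (∀ j → phiCoeff L ℓ j ≡ phiCoeff L′ ℓ j) →
  NormalisedIs L′ ℓ D N → NormalisedIs L ℓ D N
normalisedIs-cong {D = D} {N} φ≡ (c₀≢0 , ratios) =
  (λ c₀≡0 → c₀≢0 (trans (sym (φ≡ 0)) c₀≡0)) ,
  (λ j j≤ℓ → trans (cong (_*K D) (φ≡ j)) (trans (ratios j j≤ℓ) (cong (_*K N j) (sym (φ≡ 0)))))

-- The three groups

_≟K_ : DecidableEquality K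
_≟K_ = Vec.≡-dec ℚ._≟_

_≟M_ : DecidableEquality Mat
mat a b c d ≟M mat a′ b′ c′ d′ =
  map′ (λ { (refl , refl , refl , refl) → refl }) (λ { refl → refl , refl , refl , refl })
    (a ≟K a′ ×-dec b ≟K b′ ×-dec c ≟K c′ ×-dec d ≟K d′)

open import Data.List.Membership.DecPropositional _≟M_ using (_∈?_)
open import Data.List.Relation.Unary.Unique.DecPropositional _≟M_ using (unique?)

-1K : K
-1K = ιℚ (ℚ.- 1ℚ)

-- i = e^{2πi/4} is z⁶.
imaginaryUnit : K
imaginaryUnit = 0ℚ ∷ 0ℚ ∷ 0ℚ ∷ 0ℚ ∷ 0ℚ ∷ 0ℚ ∷ 1ℚ ∷ 0ℚ ∷ []

signs fourthRoots cubeRoots : List K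
signs = 1K ∷ -1K ∷ []
fourthRoots = 1K ∷ imaginaryUnit ∷ -1K ∷ (ℚ.- 1ℚ) • imaginaryUnit ∷ []
cubeRoots = 1K ∷ omega ∷ omega *K omega ∷ []

signs-powerSums : PowerSums 2 signs
signs-powerSums = record
  { roots = from-yes (all? (λ u → (u ^K 2) ≟K 1K) signs)
  ; full = from-yes (powerSum signs 0 ≟K ιℕ 2)
  ; vanishing = λ { 0 0≢0 _ → ⊥-elim (0≢0 refl)
                  ; 1 _ _ → from-yes (powerSum signs 1 ≟K 0K)
                  ; (suc (suc _)) _ (s≤s (s≤s ())) } }

cubeRoots-powerSums : PowerSums 3 cubeRoots
cubeRoots-powerSums = record
  { roots = from-yes (all? (λ u → (u ^K 3) ≟K 1K) cubeRoots)
  ; full = from-yes (powerSum cubeRoots 0 ≟K ιℕ 3)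
  ; vanishing = λ { 0 0≢0 _ → ⊥-elim (0≢0 refl)
                  ; 1 _ _ → from-yes (powerSum cubeRoots 1 ≟K 0K)
                  ; 2 _ _ → from-yes (powerSum cubeRoots 2 ≟K 0K)
                  ; (suc (suc (suc _))) _ (s≤s (s≤s (s≤s ()))) } }

fourthRoots-powerSums : PowerSums 4 fourthRoots
fourthRoots-powerSums = record
  { roots = from-yes (all? (λ u → (u ^K 4) ≟K 1K) fourthRoots)
  ; full = from-yes (powerSum fourthRoots 0 ≟K ιℕ 4)
  ; vanishing = λ { 0 0≢0 _ → ⊥-elim (0≢0 refl)
                  ; 1 _ _ → from-yes (powerSum fourthRoots 1 ≟K 0K)
                  ; 2 _ _ → from-yes (powerSum fourthRoots 2 ≟K 0K)
                  ; 3 _ _ → from-yes (powerSum fourthRoots 3 ≟K 0K)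
                  ; (suc (suc (suc (suc _)))) _ (s≤s (s≤s (s≤s (s≤s ())))) } }

base-I base-III base-IV : List Mat
base-I   = (IdM ∷ swapM ∷ []) ++ rootMatrices invSqrt2 (ιℕ 1) signs
base-III = (IdM ∷ []) ++ rootMatrices invSqrt3 (ιℕ 2) cubeRoots
base-IV  = (IdM ∷ []) ++ rootMatrices (ιℚ half) (ιℕ 3) signs

-- The lengths are 2·2·4 = 16, 4·3·4 = 48 and 2·2·3 = 12, the orders of the three groups.
list-I list-III list-IV : List Mat
list-I   = expand signs signs base-I
list-III = expand fourthRoots cubeRoots base-III
list-IV  = expand signs signs base-IV

stable? : ∀ σ L → Dec (All (λ τ → σ *M τ ∈ L) L)
stable? σ L = all? (λ τ → (σ *M τ) ∈? L) L

-- The powers `g ^M k` and `h ^M m` serve as left inverses of the generators, so `k` and `m` are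
-- their orders minus one.
enumerates : ∀ {g h} k m U W B → let L = expand U W B in
  Unique L → IdM ∈ L →
  All (λ τ → g *M τ ∈ L) L → (g ^M k) *M g ≡ IdM →
  All (λ τ → h *M τ ∈ L) L → (h ^M m) *M h ≡ IdM →
  All (λ u → Gen g h (diag u u)) U → All (λ w → Gen g h (diag 1K w)) W → All (Gen g h) B →
  Enumerates L (Gen g h)
enumerates {g} {h} k m U W B L! id∈ gL gᵏg hL hᵐh GU GW GB = L! , λ σ → mk⇔
  (expand⁻ {U} {W} {B} (Gen g h) mul GU GW GB)
  (Gen⇒∈ id∈ (finiteOrder⇒Invertible g k (All.lookup gL) gᵏg) (finiteOrder⇒Invertible h m (All.lookup hL) hᵐh))
  where open Closure (expand U W B)

list-I-unique : Unique list-I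
list-I-unique = from-yes (unique? list-I)

Id∈list-I : IdM ∈ list-I
Id∈list-I = from-yes (IdM ∈? list-I)

HI-stable : All (λ τ → HI *M τ ∈ list-I) list-I
HI-stable = from-yes (stable? HI list-I)

HI-order : (HI ^M 1) *M HI ≡ IdM
HI-order = from-yes (((HI ^M 1) *M HI) ≟M IdM)

SI-stable : All (λ τ → SI *M τ ∈ list-I) list-I
SI-stable = from-yes (stable? SI list-I)

SI-order : (SI ^M 1) *M SI ≡ IdM
SI-order = from-yes (((SI ^M 1) *M SI) ≟M IdM)

list-III-unique : Unique list-III
list-III-unique = from-yes (unique? list-III)

Id∈list-III : IdM ∈ list-III
Id∈list-III = from-yes (IdM ∈? list-III)

HIII-stable : All (λ τ → HIII *M τ ∈ list-III) list-III
HIII-stable = from-yes (stable? HIII list-III)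

HIII-order : (HIII ^M 1) *M HIII ≡ IdM
HIII-order = from-yes (((HIII ^M 1) *M HIII) ≟M IdM)

SIII-stable : All (λ τ → SIII *M τ ∈ list-III) list-III
SIII-stable = from-yes (stable? SIII list-III)

SIII-order : (SIII ^M 2) *M SIII ≡ IdM
SIII-order = from-yes (((SIII ^M 2) *M SIII) ≟M IdM)

list-IV-unique : Unique list-IV
list-IV-unique = from-yes (unique? list-IV)

Id∈list-IV : IdM ∈ list-IV
Id∈list-IV = from-yes (IdM ∈? list-IV)

HIV-stable : All (λ τ → HIV *M τ ∈ list-IV) list-IV
HIV-stable = from-yes (stable? HIV list-IV)

HIV-order : (HIV ^M 1) *M HIV ≡ IdM
HIV-order = from-yes (((HIV ^M 1) *M HIV) ≟M IdM)

SIV-stable : All (λ τ → SIV *M τ ∈ list-IV) list-IV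
SIV-stable = from-yes (stable? SIV list-IV)

SIV-order : (SIV ^M 1) *M SIV ≡ IdM
SIV-order = from-yes (((SIV ^M 1) *M SIV) ≟M IdM)

Gen-^ : ∀ {g h} σ n → Gen g h σ → Gen g h (σ ^M n)
Gen-^ σ zero    p = one
Gen-^ σ (suc n) p = mul p (Gen-^ σ n p)

-- Constructors of `Gen` yield words in the generators. The implicit argument compares the value of
-- such a word with an explicit matrix by evaluation.
gen-evaluated : ∀ {g h} σ τ → Gen g h σ → {True (σ ≟M τ)} → Gen g h τ
gen-evaluated {g} {h} σ τ p {σ≡τ} = subst (Gen g h) (toWitness σ≡τ) p

-- Powers of R = HS supply the scalars, by the Cayley-Hamilton theorem. Type I: R² - √2 R + 1 = 0,
-- whence R⁴ = -1. Type IV: R² - R + 1 = 0, whence R³ = -1. Type III: R² - TR + T² = 0 with T = (1 -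
-- ω)/√3 and T³ = -i, whence R³ = -T³ = i.
R-I R-III R-IV : Mat
R-I   = HI *M SI
R-III = HIII *M SIII
R-IV  = HIV *M SIV

gen-R-I : G-I R-I
gen-R-I = mul {σ = HI} {SI} gen₁ gen₂

gen-R-III : G-III R-III
gen-R-III = mul {σ = HIII} {SIII} gen₁ gen₂

gen-R-IV : G-IV R-IV
gen-R-IV = mul {σ = HIV} {SIV} gen₁ gen₂

scalars-I : All (λ u → G-I (diag u u)) signs
scalars-I = one ∷ gen-evaluated (R-I ^M 4) (diag -1K -1K) (Gen-^ R-I 4 gen-R-I) ∷ []

base-I-gen : All G-I base-I
base-I-gen = one
  ∷ gen-evaluated ((R-I ^M 2) *M SI) swapM (mul {σ = R-I ^M 2} {SI} (Gen-^ R-I 2 gen-R-I) gen₂)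
  ∷ gen-evaluated HI (rootMatrix invSqrt2 (ιℕ 1) 1K) gen₁
  ∷ gen-evaluated R-I (rootMatrix invSqrt2 (ιℕ 1) -1K) gen-R-I
  ∷ []

scalars-III : All (λ u → G-III (diag u u)) fourthRoots
scalars-III = one
  ∷ gen-evaluated (R-III ^M 3) (diag imaginaryUnit imaginaryUnit) (Gen-^ R-III 3 gen-R-III)
  ∷ gen-evaluated (R-III ^M 6) (diag -1K -1K) (Gen-^ R-III 6 gen-R-III)
  ∷ gen-evaluated (R-III ^M 9) (diag ((ℚ.- 1ℚ) • imaginaryUnit) ((ℚ.- 1ℚ) • imaginaryUnit)) (Gen-^ R-III 9 gen-R-III)
  ∷ []

twists-III : All (λ w → G-III (diag 1K w)) cubeRoots
twists-III = one ∷ gen₂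
  ∷ gen-evaluated (SIII *M SIII) (diag 1K (omega *K omega)) (mul {σ = SIII} {SIII} gen₂ gen₂)
  ∷ []

base-III-gen : All G-III base-III
base-III-gen = one
  ∷ gen-evaluated HIII (rootMatrix invSqrt3 (ιℕ 2) 1K) gen₁
  ∷ gen-evaluated R-III (rootMatrix invSqrt3 (ιℕ 2) omega) gen-R-III
  ∷ gen-evaluated (R-III *M SIII) (rootMatrix invSqrt3 (ιℕ 2) (omega *K omega)) (mul {σ = R-III} {SIII} gen-R-III gen₂)
  ∷ []

scalars-IV : All (λ u → G-IV (diag u u)) signs
scalars-IV = one ∷ gen-evaluated (R-IV ^M 3) (diag -1K -1K) (Gen-^ R-IV 3 gen-R-IV) ∷ []

base-IV-gen : All G-IV base-IV
base-IV-gen = one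
  ∷ gen-evaluated HIV (rootMatrix (ιℚ half) (ιℕ 3) 1K) gen₁
  ∷ gen-evaluated R-IV (rootMatrix (ιℚ half) (ιℕ 3) -1K) gen-R-IV
  ∷ []

enumerates-I : Enumerates list-I G-I
enumerates-I = enumerates 1 1 signs signs base-I list-I-unique Id∈list-I
  HI-stable HI-order SI-stable SI-order scalars-I (one ∷ gen₂ ∷ []) base-I-gen

enumerates-III : Enumerates list-III G-III
enumerates-III = enumerates 1 2 fourthRoots cubeRoots base-III list-III-unique Id∈list-III
  HIII-stable HIII-order SIII-stable SIII-order scalars-III twists-III base-III-gen

enumerates-IV : Enumerates list-IV G-IV
enumerates-IV = enumerates 1 1 signs signs base-IV list-IV-unique Id∈list-IV
  HIV-stable HIV-order SIV-stable SIV-order scalars-IV (one ∷ gen₂ ∷ []) base-IV-gen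

-- With |U|·|W| in the numerator and the group order |U|·|W|·|B| below, the constant is 1/|B|. Its
-- inverse is the number of base matrices: 4, 4 and 3 for the three types.
γ-I : (invLength list-I • (ιℕ 2 *K ιℕ 2)) *K ιℕ 4 ≡ 1K
γ-I = from-yes (((invLength list-I • (ιℕ 2 *K ιℕ 2)) *K ιℕ 4) ≟K 1K)

γ-III : (invLength list-III • (ιℕ 4 *K ιℕ 3)) *K ιℕ 4 ≡ 1K
γ-III = from-yes (((invLength list-III • (ιℕ 4 *K ιℕ 3)) *K ιℕ 4) ≟K 1K)

γ-IV : (invLength list-IV • (ιℕ 2 *K ιℕ 2)) *K ιℕ 3 ≡ 1K
γ-IV = from-yes (((invLength list-IV • (ιℕ 2 *K ιℕ 2)) *K ιℕ 3) ≟K 1K)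

invSqrt2-sqrt2 : invSqrt2 *K sqrt2 ≡ 1K
invSqrt2-sqrt2 = from-yes ((invSqrt2 *K sqrt2) ≟K 1K)

sqrt2² : sqrt2 ^K 2 ≡ ιℕ 2
sqrt2² = from-yes ((sqrt2 ^K 2) ≟K ιℕ 2)

invSqrt3-sqrt3 : invSqrt3 *K sqrt3 ≡ 1K
invSqrt3-sqrt3 = from-yes ((invSqrt3 *K sqrt3) ≟K 1K)

sqrt3⁴ : sqrt3 ^K 4 ≡ ιℕ 9
sqrt3⁴ = from-yes ((sqrt3 ^K 4) ≟K ιℕ 9)

half-2 : ιℚ half *K ιℕ 2 ≡ 1K
half-2 = from-yes ((ιℚ half *K ιℕ 2) ≟K 1K)

2² : ιℕ 2 ^K 2 ≡ ιℕ 4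
2² = from-yes ((ιℕ 2 ^K 2) ≟K ιℕ 4)

phiZero-list-I : ∀ {ℓ} → ¬ 2 ∣ ℓ → PhiZero list-I ℓ
phiZero-list-I = phiZero-expand signs signs base-I signs-powerSums

phiZero-list-III : ∀ {ℓ} → ¬ 4 ∣ ℓ → PhiZero list-III ℓ
phiZero-list-III = phiZero-expand fourthRoots cubeRoots base-III fourthRoots-powerSums

phiZero-list-IV : ∀ {ℓ} → ¬ 2 ∣ ℓ → PhiZero list-IV ℓ
phiZero-list-IV = phiZero-expand signs signs base-IV signs-powerSums

normalised-list-I : ∀ {ℓ} → 2 ∣ ℓ → ℓ ≢ 0 → NormalisedIs list-I ℓ (DenI ℓ) (NumI ℓ)
-- Evenness enters twice: it makes the power sum of the scalars nonzero, and it makes √2^ℓ an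
-- integer.
normalised-list-I 2∣ℓ = Ratio-I.normalised-I {invSqrt2} {sqrt2} {signs} {ιℕ 4} {2} {2} signs-powerSums
  invSqrt2-sqrt2 sqrt2² γ-I 2∣ℓ 2∣ℓ

module Ratio-III = Ratio {4} {3} {2} {invSqrt3} {sqrt3} {fourthRoots} {cubeRoots} {ιℕ 4} {4} {9}
  fourthRoots-powerSums cubeRoots-powerSums invSqrt3-sqrt3 sqrt3⁴

normalised-list-III : ∀ {ℓ} → 4 ∣ ℓ → NormalisedIs list-III ℓ (DenIII ℓ) (NumIII ℓ)
normalised-list-III {ℓ} 4∣ℓ =
  Ratio-III.normalisedIs-expand (IdM ∷ []) γ-III 4∣ℓ 4∣ℓ (NumIII ℓ) (+K-identityʳ (DenIII ℓ)) Ratio-III.X≡Num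

module Ratio-IV = Ratio {2} {2} {3} {ιℚ half} {ιℕ 2} {signs} {signs} {ιℕ 3} {2} {4}
  signs-powerSums signs-powerSums half-2 2²

normalised-list-IV : ∀ {ℓ} → 2 ∣ ℓ → NormalisedIs list-IV ℓ (DenIV ℓ) (NumIV ℓ)
normalised-list-IV {ℓ} 2∣ℓ =
  Ratio-IV.normalisedIs-expand (IdM ∷ []) γ-IV 2∣ℓ 2∣ℓ (NumIV ℓ) (+K-identityʳ (DenIV ℓ)) Ratio-IV.X≡Num

theorem2p3 : (∃ λ L → Enumerates L G-I) × (∃ λ L → Enumerates L G-III) × (∃ λ L → Enumerates L G-IV)
    × (∀ (L : List Mat) → Enumerates L G-I → ∀ (ℓ : ℕ) →
    (¬ (2 ∣ ℓ) → PhiZero L ℓ)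
    × (2 ∣ ℓ → ℓ ≢ 0 → NormalisedIs L ℓ (DenI ℓ) (NumI ℓ)))
    × (∀ (L : List Mat) → Enumerates L G-III → ∀ (ℓ : ℕ) →
    (¬ (4 ∣ ℓ) → PhiZero L ℓ)
    × (4 ∣ ℓ → NormalisedIs L ℓ (DenIII ℓ) (NumIII ℓ)))
    × (∀ (L : List Mat) → Enumerates L G-IV → ∀ (ℓ : ℕ) →
    (¬ (2 ∣ ℓ) → PhiZero L ℓ)
    × (2 ∣ ℓ → NormalisedIs L ℓ (DenIV ℓ) (NumIV ℓ)))
theorem2p3 =
  (list-I , enumerates-I) , (list-III , enumerates-III) , (list-IV , enumerates-IV) ,
  (λ L E ℓ → let φ≡ = phiCoeff-unique E enumerates-I ℓ in
    (λ ∤ℓ → phiZero-cong {L} {list-I} φ≡ (phiZero-list-I ∤ℓ)) ,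
    (λ ∣ℓ ℓ≢0 → normalisedIs-cong {L} {list-I} {ℓ} {DenI ℓ} {NumI ℓ} φ≡ (normalised-list-I ∣ℓ ℓ≢0))) ,
  (λ L E ℓ → let φ≡ = phiCoeff-unique E enumerates-III ℓ in
    (λ ∤ℓ → phiZero-cong {L} {list-III} φ≡ (phiZero-list-III ∤ℓ)) ,
    (λ ∣ℓ → normalisedIs-cong {L} {list-III} {ℓ} {DenIII ℓ} {NumIII ℓ} φ≡ (normalised-list-III ∣ℓ))) ,
  (λ L E ℓ → let φ≡ = phiCoeff-unique E enumerates-IV ℓ in
    (λ ∤ℓ → phiZero-cong {L} {list-IV} φ≡ (phiZero-list-IV ∤ℓ)) ,
    (λ ∣ℓ → normalisedIs-cong {L} {list-IV} {ℓ} {DenIV ℓ} {NumIV ℓ} φ≡ (normalised-list-IV ∣ℓ)))
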